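{- (i) For every positive integer $k$, the subdivision of the complete graph $K_k$ has Sidorenko's property. (ii) If a graph $H$ has Sidorenko's property, then the subdivision of $H$ also has Sidorenko's property.
   Context: All graphs are finite and simple. $\mathrm{Hom}(H,G)$ is the set of graph homomorphisms from $H$ to $G$. A graph $H$ has Sidorenko's property if for every graph $G$, $|\mathrm{Hom}(H,G)|\ge |V(G)|^{|V(H)|}\left(\frac{2|E(G)|}{|V(G)|^2}\right)^{|E(H)|}$. The subdivision of a graph $H$ is the graph obtained from $H$ by replacing each edge by a path of length two, these paths being internally vertex-disjoint (i.e. each edge receives its own new middle vertex). -}

module Defs where

open import Data.Nat using (ℕ; zero; suc; _+_; _*_; _^_; _≤_)
open import Data.Bool using (Bool; true; false; _∧_; _∨_; not; if_then_else_)
open import Data.Fin using (Fin; splitAt)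
open import Data.Fin.Properties using (_≟_; _<?_)
open import Data.List using (List; []; _∷_; [_]; length; map; concatMap; lookup)
open import Data.Bool.ListAction using (and)
open import Data.Nat.ListAction using (sum)
open import Data.List.Base using (allFin)
open import Data.Vec using (Vec) renaming ([] to []ᵥ; _∷_ to _∷ᵥ_; lookup to lookupᵥ)
open import Data.Sum using (_⊎_; inj₁; inj₂)
open import Data.Product using (_×_; _,_)
open import Relation.Nullary.Decidable using (⌊_⌋; yes; no)
open import Relation.Binary.PropositionalEquality using (_≡_; refl; _≢_; sym)

record Graph : Set where
  field
    order : ℕ
    adj   : Fin order → Fin order → Bool
    adj-sym : ∀ i j → adj i j ≡ adj j i
    adj-irr : ∀ i → adj i i ≡ false
open Graph public

edges : (G : Graph) → List (Fin (order G) × Fin (order G))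
edges G = concatMap (λ a → concatMap (λ b →
            if ⌊ a <? b ⌋ ∧ adj G a b then [ (a , b) ] else [])
            (allFin (order G))) (allFin (order G))

numEdges : Graph → ℕ
numEdges G = length (edges G)

allMaps : (v n : ℕ) → List (Vec (Fin n) v)
allMaps zero n = []ᵥ ∷ []
allMaps (suc v) n = concatMap (λ a → map (a ∷ᵥ_) (allMaps v n)) (allFin n)

isHom : (H G : Graph) → Vec (Fin (order G)) (order H) → Bool
isHom H G f = and (concatMap (λ i → map (λ j →
                 not (adj H i j) ∨ adj G (lookupᵥ f i) (lookupᵥ f j))
                 (allFin (order H))) (allFin (order H)))

homCount : Graph → Graph → ℕ
homCount H G = sum (map (λ f → if isHom H G f then 1 else 0) (allMaps (order H) (order G)))

-- Sidorenko's property, with denominators cleared: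
--   |Hom(H,G)| ≥ n^{v(H)} (2e(G)/n^2)^{e(H)}
--   ⇔ n^{v(H)} (2 e(G))^{e(H)} ≤ |Hom(H,G)| · n^{2 e(H)}.
Sidorenko : Graph → Set
Sidorenko H = (G : Graph) →
  order G ^ order H * (2 * numEdges G) ^ numEdges H
    ≤ homCount H G * order G ^ (2 * numEdges H)

complete : ℕ → Graph
complete k = record
  { order = k
  ; adj = λ i j → not ⌊ i ≟ j ⌋
  ; adj-sym = sy
  ; adj-irr = λ i → irr i
  }
  where
  irr : ∀ (i : Fin k) → not ⌊ i ≟ i ⌋ ≡ false
  irr i with i ≟ i
  ... | yes _ = refl
  ... | no ¬p with ¬p refl
  ... | ()
  sy : ∀ (i j : Fin k) → not ⌊ i ≟ j ⌋ ≡ not ⌊ j ≟ i ⌋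
  sy i j with i ≟ j | j ≟ i
  ... | yes _ | yes _ = refl
  ... | no _ | no _ = refl
  ... | yes p | no q with q (sym p)
  ... | ()
  sy i j | no q | yes p with q (sym p)
  ... | ()

-- Subdivision: vertices Fin (v + m), the first v original, the last m one per
-- edge of H (in the order of `edges H`); original vertex i is adjacent to
-- edge-vertex e iff i is an endpoint of e; no other adjacencies.
module _ (H : Graph) where
  private
    v = order H
    m = numEdges H

    endpoint : Fin v → Fin m → Bool
    endpoint i e with lookup (edges H) e
    ... | (a , b) = ⌊ i ≟ a ⌋ ∨ ⌊ i ≟ b ⌋

    sadj : Fin v ⊎ Fin m → Fin v ⊎ Fin m → Bool
    sadj (inj₁ i) (inj₂ e) = endpoint i e
    sadj (inj₂ e) (inj₁ i) = endpoint i e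
    sadj (inj₁ _) (inj₁ _) = false
    sadj (inj₂ _) (inj₂ _) = false

    sadj-sym : ∀ s t → sadj s t ≡ sadj t s
    sadj-sym (inj₁ i) (inj₂ e) = refl
    sadj-sym (inj₂ e) (inj₁ i) = refl
    sadj-sym (inj₁ _) (inj₁ _) = refl
    sadj-sym (inj₂ _) (inj₂ _) = refl

    sadj-irr : ∀ s → sadj s s ≡ false
    sadj-irr (inj₁ _) = refl
    sadj-irr (inj₂ _) = refl

  subdivision : Graph
  subdivision = record
    { order = v + m
    ; adj = λ x y → sadj (splitAt v x) (splitAt v y)
    ; adj-sym = λ x y → sadj-sym (splitAt v x) (splitAt v y)
    ; adj-irr = λ x → sadj-irr (splitAt v x)
    }

{-# OPTIONS --safe #-}
module Submission where

-- Put W(x, y) = codeg(x, y), s = ∑ W, n = |V(G)|. Summing over the middle vertices gives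
-- |Hom(sub H, G)| = ∑_f ∏_{ab ∈ E(H)} W(f a, f b) =: hom(H, W), and (2e(G))² ≤ n s by Cauchy–Schwarz,
-- so it suffices that n^{v(H)} s^{e(H)} ≤ hom(H, W) n^{2e(H)}.
--
-- H = K_k: let d(x) = ∑_y W(x, y) and S_j = ∑_{x ∈ V^j} ∏_{i<i'} W(x_i, x_i') ∏_i d(x_i)^{k-j}. As W is a
-- Gram matrix, ⟨a, W 1⟩² ≤ ⟨a, W a⟩ s; applied to the last two of j+2 clique vertices, and followed by
-- Cauchy–Schwarz over the other j, it gives S_{j+1}² ≤ S_{j+2} S_j s. Hence S_1^k ≤ S_k s^{k(k-1)/2}
-- with S_k = hom(K_k, W), and S_1 = ∑ d^{k-1} is bounded below by the power mean inequality.
--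
-- H Sidorenko: a symmetric relation with loops becomes a simple graph after tensoring with K_2, which
-- costs 2^{e(H)}. A weight below 2^L is at most twice the sum of its L weighted level sets 2^i [2^i ≤ w],
-- so the weighted inequality holds up to a factor (4L)^{e(H)}. For the k-th tensor power of W this loss
-- is polynomial in k, while both sides of the inequality are k-th powers; so there is no loss for W.

open import Defs
open import Algebra.Bundles using (CommutativeSemigroup)
open import Algebra.Structures using (IsCommutativeMonoid)
import Algebra.Properties.CommutativeSemigroup as CommutativeSemigroupProperties
open import Data.Bool using (Bool; true; false; _∧_; _∨_; not; if_then_else_)
open import Data.Bool.ListAction using (and)
open import Data.Bool.Properties using (∧-zeroʳ)
open import Data.Fin as Fin using (Fin; zero; suc; _↑ˡ_; _↑ʳ_; combine; remQuot)
open import Data.Fin.Properties using (_≟_; _<?_; <-cmp; splitAt-↑ˡ; splitAt-↑ʳ; remQuot-combine)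
  renaming (<⇒≢ to Fin-<⇒≢)
open import Data.List using (List; []; _∷_; _++_; foldr; map; concatMap; length; lookup; [_])
open import Data.List.Base using (allFin; downFrom)
open import Data.List.Properties
  using (map-tabulate; tabulate-lookup; map-cong; map-∘; length-tabulate; length-downFrom)
open import Data.Nat hiding (_≟_; _<?_; <-cmp)
open import Data.Nat.Properties hiding (_≟_; _<?_; <-cmp)
open import Data.Nat.Tactic.RingSolver using (solve-∀)
open import Data.Product using (_×_; _,_; proj₁; proj₂; ∃)
open import Data.Vec using (Vec; []; _∷_; zipWith) renaming (lookup to lookupᵥ; _++_ to _++ᵥ_)
open import Data.Vec.Properties using (lookup-++ˡ; lookup-++ʳ; lookup-zipWith)
open import Function using (_∘_; id)
open import Relation.Binary.Definitions using (tri<; tri≈; tri>)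
open import Relation.Binary.PropositionalEquality hiding ([_])
open import Relation.Nullary using (yes; no; contradiction)
open import Relation.Nullary.Decidable using (⌊_⌋; isYes≗does)

private variable
  A B : Set
  m n v : ℕ

-- Finite sums and products

-- Sums and products are treated at once because the same rearrangements over vertices and edges
-- serve twice: with `*` they factor the weight of a map, with `+` they count edges.
module BigOp {_∙_ : ℕ → ℕ → ℕ} {ε : ℕ} (isCM : IsCommutativeMonoid _≡_ _∙_ ε) where
  open IsCommutativeMonoid isCM using (assoc; identityˡ; identityʳ; isCommutativeSemigroup)
  open ≡-Reasoning

  commutativeSemigroup : CommutativeSemigroup _ _
  commutativeSemigroup = record { isCommutativeSemigroup = isCommutativeSemigroup }
  open CommutativeSemigroupProperties commutativeSemigroup using (interchange)

  fold : List A → (A → ℕ) → ℕ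
  fold xs f = foldr _∙_ ε (map f xs)

  when : Bool → ℕ → ℕ
  when b x = if b then x else ε

  fold-cong : (xs : List A) {f g : A → ℕ} → (∀ x → f x ≡ g x) → fold xs f ≡ fold xs g
  fold-cong xs eq = cong (foldr _∙_ ε) (map-cong eq xs)

  fold-map : (h : A → B) (xs : List A) (f : B → ℕ) → fold (map h xs) f ≡ fold xs (f ∘ h)
  fold-map h xs f = cong (foldr _∙_ ε) (sym (map-∘ xs))

  fold-++ : (xs ys : List A) (f : A → ℕ) → fold (xs ++ ys) f ≡ fold xs f ∙ fold ys f
  fold-++ []       ys f = sym (identityˡ _)
  fold-++ (x ∷ xs) ys f = trans (cong (f x ∙_) (fold-++ xs ys f)) (sym (assoc _ _ _))

  fold-concatMap : (h : A → List B) (xs : List A) (f : B → ℕ) →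
    fold (concatMap h xs) f ≡ fold xs λ x → fold (h x) f
  fold-concatMap h []       f = refl
  fold-concatMap h (x ∷ xs) f =
    trans (fold-++ (h x) _ f) (cong (fold (h x) f ∙_) (fold-concatMap h xs f))

  fold-ε : (xs : List A) → fold xs (λ _ → ε) ≡ ε
  fold-ε []       = refl
  fold-ε (x ∷ xs) = trans (identityˡ _) (fold-ε xs)

  fold-∙ : (xs : List A) (f g : A → ℕ) → fold xs (λ x → f x ∙ g x) ≡ fold xs f ∙ fold xs g
  fold-∙ []       f g = sym (identityˡ _)
  fold-∙ (x ∷ xs) f g = trans (cong ((f x ∙ g x) ∙_) (fold-∙ xs f g)) (interchange _ _ _ _)

  fold-swap : (xs : List A) (ys : List B) (f : A → B → ℕ) →
    (fold xs λ x → fold ys λ y → f x y) ≡ (fold ys λ y → fold xs λ x → f x y)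
  fold-swap []       ys f = sym (fold-ε ys)
  fold-swap (x ∷ xs) ys f =
    trans (cong (fold ys (f x) ∙_) (fold-swap xs ys f)) (sym (fold-∙ ys _ _))

  fold-suc : (f : Fin (suc n) → ℕ) → fold (allFin (suc n)) f ≡ f zero ∙ fold (allFin n) (f ∘ suc)
  fold-suc f = cong (λ l → f zero ∙ foldr _∙_ ε l)
    (trans (map-tabulate suc f) (sym (map-tabulate id (f ∘ suc))))

  fold-+ : ∀ m n (f : Fin (m + n) → ℕ) →
    fold (allFin (m + n)) f ≡ fold (allFin m) (λ i → f (i ↑ˡ n)) ∙ fold (allFin n) (λ j → f (m ↑ʳ j))
  fold-+ zero    n f = sym (identityˡ _)
  fold-+ (suc m) n f = begin
    fold (allFin (suc m + n)) f                  ≡⟨ fold-suc f ⟩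
    f zero ∙ fold (allFin (m + n)) (f ∘ suc)     ≡⟨ cong (f zero ∙_) (fold-+ m n (f ∘ suc)) ⟩
    f zero ∙ (fold (allFin m) (fˡ ∘ suc) ∙ right) ≡⟨ assoc _ _ _ ⟨
    (f zero ∙ fold (allFin m) (fˡ ∘ suc)) ∙ right ≡⟨ cong (_∙ right) (fold-suc fˡ) ⟨
    fold (allFin (suc m)) fˡ ∙ right             ∎
    where
    fˡ : Fin (suc m) → ℕ
    fˡ i = f (i ↑ˡ n)
    right : ℕ
    right = fold (allFin n) (λ j → f (suc m ↑ʳ j))

  fold-* : ∀ m n (f : Fin (m * n) → ℕ) →
    fold (allFin (m * n)) f ≡ fold (allFin m) λ i → fold (allFin n) λ j → f (combine i j)
  fold-* zero    n f = refl
  fold-* (suc m) n f = begin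
    fold (allFin (n + m * n)) f  ≡⟨ fold-+ n (m * n) f ⟩
    row zero ∙ fold (allFin (m * n)) (λ k → f (n ↑ʳ k))
      ≡⟨ cong (row zero ∙_) (fold-* m n (λ k → f (n ↑ʳ k))) ⟩
    row zero ∙ fold (allFin m) (row ∘ suc) ≡⟨ fold-suc row ⟨
    fold (allFin (suc m)) row ∎
    where
    row : Fin (suc m) → ℕ
    row i = fold (allFin n) λ j → f (combine i j)

  fold-lookup : (xs : List A) (f : A → ℕ) → fold (allFin (length xs)) (f ∘ lookup xs) ≡ fold xs f
  fold-lookup xs f = trans (sym (fold-map (lookup xs) (allFin (length xs)) f))
    (cong (λ l → fold l f) (trans (map-tabulate id (lookup xs)) (tabulate-lookup xs)))

open BigOp +-0-isCommutativeMonoid using () renaming (fold to ∑)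
open BigOp *-1-isCommutativeMonoid using () renaming (fold to ∏)
module Sum = BigOp +-0-isCommutativeMonoid
module Prod = BigOp *-1-isCommutativeMonoid

∑-mono : (xs : List A) {f g : A → ℕ} → (∀ x → f x ≤ g x) → ∑ xs f ≤ ∑ xs g
∑-mono []       le = z≤n
∑-mono (x ∷ xs) le = +-mono-≤ (le x) (∑-mono xs le)

∏-mono : (xs : List A) {f g : A → ℕ} → (∀ x → f x ≤ g x) → ∏ xs f ≤ ∏ xs g
∏-mono []       le = ≤-refl
∏-mono (x ∷ xs) le = *-mono-≤ (le x) (∏-mono xs le)

*-∑ : (c : ℕ) (xs : List A) (f : A → ℕ) → c * ∑ xs f ≡ ∑ xs λ x → c * f x
*-∑ c []       f = *-zeroʳ c
*-∑ c (x ∷ xs) f = trans (*-distribˡ-+ c (f x) _) (cong (c * f x +_) (*-∑ c xs f))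

∑-* : (xs : List A) (f : A → ℕ) (c : ℕ) → ∑ xs f * c ≡ ∑ xs λ x → f x * c
∑-* xs f c = trans (*-comm _ c) (trans (*-∑ c xs f) (Sum.fold-cong xs λ x → *-comm c (f x)))

∑-*-∑ : (xs : List A) (ys : List B) (f : A → ℕ) (g : B → ℕ) →
  ∑ xs f * ∑ ys g ≡ ∑ xs λ x → ∑ ys λ y → f x * g y
∑-*-∑ xs ys f g = trans (∑-* xs f _) (Sum.fold-cong xs λ x → *-∑ (f x) ys g)

∑-const : (xs : List A) (c : ℕ) → (∑ xs λ _ → c) ≡ length xs * c
∑-const []       c = refl
∑-const (x ∷ xs) c = cong (c +_) (∑-const xs c)

∏-const : (xs : List A) (c : ℕ) → (∏ xs λ _ → c) ≡ c ^ length xs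
∏-const []       c = refl
∏-const (x ∷ xs) c = cong (c *_) (∏-const xs c)

^-distribʳ-* : ∀ x y k → (x * y) ^ k ≡ x ^ k * y ^ k
^-distribʳ-* x y zero    = refl
^-distribʳ-* x y (suc k) =
  trans (cong ((x * y) *_) (^-distribʳ-* x y k)) (e x y (x ^ k) (y ^ k))
  where
  e : ∀ a b c d → a * b * (c * d) ≡ a * c * (b * d)
  e = solve-∀

^-2* : ∀ x k → x ^ (2 * k) ≡ x ^ k * x ^ k
^-2* x k = trans (cong (λ j → x ^ (k + j)) (+-identityʳ k)) (^-distribˡ-+-* x k k)

-- Cauchy-Schwarz and power mean inequalities

2*a*b≤a²+b² : ∀ a b → 2 * (a * b) ≤ a * a + b * b
2*a*b≤a²+b² zero    b       = z≤n
2*a*b≤a²+b² (suc a) zero    = ≤-trans (≤-reflexive (cong (2 *_) (*-zeroʳ a))) z≤n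
-- Raising both arguments by one adds `2 * a + 2 * b + 2` to either side, so no subtraction occurs.
2*a*b≤a²+b² (suc a) (suc b) = begin
  2 * (suc a * suc b)               ≡⟨ e₁ a b ⟩
  2 * (a * b) + (2 * a + 2 * b + 2) ≤⟨ +-monoˡ-≤ _ (2*a*b≤a²+b² a b) ⟩
  a * a + b * b + (2 * a + 2 * b + 2) ≡⟨ e₂ a b ⟩
  suc a * suc a + suc b * suc b ∎
  where
  open ≤-Reasoning
  e₁ : ∀ a b → 2 * (suc a * suc b) ≡ 2 * (a * b) + (2 * a + 2 * b + 2)
  e₁ = solve-∀
  e₂ : ∀ a b → a * a + b * b + (2 * a + 2 * b + 2) ≡ suc a * suc a + suc b * suc b
  e₂ = solve-∀

-- Twice the difference of the two sides is ∑ₓ ∑ᵧ wₓ wᵧ (aₓ bᵧ - aᵧ bₓ)².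
cauchy-schwarz : (xs : List A) (w a b : A → ℕ) →
  ∑ xs (λ x → w x * (a x * b x)) * ∑ xs (λ x → w x * (a x * b x))
    ≤ ∑ xs (λ x → w x * (a x * a x)) * ∑ xs (λ x → w x * (b x * b x))
cauchy-schwarz xs w a b = *-cancelˡ-≤ 2 (begin
  2 * (∑ xs ab * ∑ xs ab)
    ≡⟨ cong (2 *_) (∑-*-∑ xs xs ab ab) ⟩
  2 * (∑ xs λ x → ∑ xs λ y → ab x * ab y)
    ≡⟨ trans (*-∑ 2 xs _) (Sum.fold-cong xs λ x → *-∑ 2 xs _) ⟩
  (∑ xs λ x → ∑ xs λ y → 2 * (ab x * ab y))
    ≤⟨ ∑-mono xs (λ x → ∑-mono xs λ y → pointwise x y) ⟩
  (∑ xs λ x → ∑ xs λ y → aa x * bb y + aa y * bb x)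
    ≡⟨ trans (Sum.fold-cong xs λ x → Sum.fold-∙ xs _ _) (Sum.fold-∙ xs _ _) ⟩
  (∑ xs λ x → ∑ xs λ y → aa x * bb y) + (∑ xs λ x → ∑ xs λ y → aa y * bb x)
    ≡⟨ cong ((∑ xs λ x → ∑ xs λ y → aa x * bb y) +_) (Sum.fold-swap xs xs _) ⟩
  (∑ xs λ x → ∑ xs λ y → aa x * bb y) + (∑ xs λ y → ∑ xs λ x → aa y * bb x)
    ≡⟨ cong (λ t → t + t) (∑-*-∑ xs xs aa bb) ⟨
  ∑ xs aa * ∑ xs bb + ∑ xs aa * ∑ xs bb
    ≡⟨ cong (∑ xs aa * ∑ xs bb +_) (+-identityʳ _) ⟨
  2 * (∑ xs aa * ∑ xs bb) ∎)
  where
  open ≤-Reasoning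
  ab = λ x → w x * (a x * b x)
  aa = λ x → w x * (a x * a x)
  bb = λ x → w x * (b x * b x)
  lhs : ∀ u v p q r s → 2 * (u * (p * q) * (v * (r * s))) ≡ u * v * (2 * ((p * s) * (r * q)))
  lhs = solve-∀
  rhs : ∀ u v p q r s → u * v * ((p * s) * (p * s) + (r * q) * (r * q))
        ≡ u * (p * p) * (v * (s * s)) + v * (r * r) * (u * (q * q))
  rhs = solve-∀
  pointwise : ∀ x y → 2 * (ab x * ab y) ≤ aa x * bb y + aa y * bb x
  pointwise x y = begin
    2 * (ab x * ab y) ≡⟨ lhs (w x) (w y) (a x) (b x) (a y) (b y) ⟩
    w x * w y * (2 * ((a x * b y) * (a y * b x)))
      ≤⟨ *-monoʳ-≤ (w x * w y) (2*a*b≤a²+b² (a x * b y) (a y * b x)) ⟩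
    w x * w y * ((a x * b y) * (a x * b y) + (a y * b x) * (a y * b x))
      ≡⟨ rhs (w x) (w y) (a x) (b x) (a y) (b y) ⟩
    aa x * bb y + aa y * bb x ∎

unweighted-cauchy-schwarz : (xs : List A) (a b : A → ℕ) →
  ∑ xs (λ x → a x * b x) * ∑ xs (λ x → a x * b x)
    ≤ ∑ xs (λ x → a x * a x) * ∑ xs (λ x → b x * b x)
unweighted-cauchy-schwarz xs a b = subst₂ _≤_
  (cong₂ _*_ (one _) (one _)) (cong₂ _*_ (one _) (one _))
  (cauchy-schwarz xs (λ _ → 1) a b)
  where
  one : ∀ f → ∑ xs (λ x → 1 * f x) ≡ ∑ xs f
  one f = Sum.fold-cong xs λ x → *-identityˡ (f x)

m*m≤0⇒m≡0 : m * m ≤ 0 → m ≡ 0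
m*m≤0⇒m≡0 {m = zero} _ = refl

-- With `r_j = S (suc j) / S j` the hypothesis reads `r_j ≤ t * r_(j+1)`; iteration gives
-- `r_0 ≤ t ^ j * r_j`, here with denominators cleared. The cutoff `k` serves `clique-bound`, whose
-- sequence is shown to be log-convex only in a bounded range.
log-convex⇒ratio : (S : ℕ → ℕ) (t k : ℕ) →
  (∀ j → 2 + j ≤ k → S (suc j) * S (suc j) ≤ S (2 + j) * S j * t) →
  ∀ j → suc j ≤ k → S j * S 1 ≤ S (suc j) * t ^ j * S 0
log-convex⇒ratio S t k convex zero    _ = ≤-reflexive (e (S 0) (S 1))
  where
  e : ∀ a b → a * b ≡ b * 1 * a
  e = solve-∀
log-convex⇒ratio S t k convex (suc j) le with S j in eq
-- The ratio is undefined here, but convexity forces `S (suc j)` to vanish, and the left side with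
-- it.
... | zero = subst (λ z → z * S 1 ≤ S (2 + j) * t ^ suc j * S 0) (sym S≡0) z≤n
  where
  S≡0 : S (suc j) ≡ 0
  S≡0 = m*m≤0⇒m≡0 (≤-trans (convex j le) (≤-reflexive
    (trans (cong (λ z → S (2 + j) * z * t) eq) (cong (_* t) (*-zeroʳ (S (2 + j)))))))
-- Multiply by `S j`, use the bound for `j`, then convexity, and cancel the positive factor.
... | suc s = *-cancelˡ-≤ (suc s) (begin
  suc s * (S₁ * S 1)          ≡⟨ e₁ (suc s) S₁ (S 1) ⟩
  S₁ * (suc s * S 1)          ≡⟨ cong (λ z → S₁ * (z * S 1)) eq ⟨
  S₁ * (S j * S 1)            ≤⟨ *-monoʳ-≤ S₁ (log-convex⇒ratio S t k convex j (≤-trans (n≤1+n _) le)) ⟩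
  S₁ * (S₁ * t ^ j * S 0)     ≡⟨ e₂ S₁ (t ^ j) (S 0) ⟩
  S₁ * S₁ * (t ^ j * S 0)     ≤⟨ *-monoˡ-≤ (t ^ j * S 0) (convex j le) ⟩
  S₂ * S j * t * (t ^ j * S 0) ≡⟨ cong (λ z → S₂ * z * t * (t ^ j * S 0)) eq ⟩
  S₂ * suc s * t * (t ^ j * S 0) ≡⟨ e₃ S₂ (suc s) t (t ^ j) (S 0) ⟩
  suc s * (S₂ * (t * t ^ j) * S 0) ∎)
  where
  open ≤-Reasoning
  S₁ = S (suc j)
  S₂ = S (2 + j)
  e₁ : ∀ a b c → a * (b * c) ≡ b * (a * c)
  e₁ = solve-∀
  e₂ : ∀ a b c → a * (a * b * c) ≡ a * a * (b * c)
  e₂ = solve-∀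
  e₃ : ∀ a b c d e → a * b * c * (d * e) ≡ b * (a * (c * d) * e)
  e₃ = solve-∀

-- Induction on the exponent: by Cauchy-Schwarz with weight `f x ^ i` the power sums `P i` are
-- log-convex with `t = 1`, which gives `P j * P 1 ≤ P (suc j) * P 0`.
power-mean : (xs : List A) (f : A → ℕ) (j : ℕ) →
  length xs * ∑ xs f ^ j ≤ length xs ^ j * ∑ xs (λ x → f x ^ j)
power-mean xs f zero    = ≤-reflexive (trans (sym (∑-const xs 1)) (sym (+-identityʳ _)))
power-mean {A} xs f (suc j) = begin
  N * (s * s ^ j)         ≡⟨ e₁ N s (s ^ j) ⟩
  N * s ^ j * s           ≤⟨ *-monoˡ-≤ s (power-mean xs f j) ⟩
  N ^ j * P j * s         ≡⟨ e₂ (N ^ j) (P j) s ⟩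
  N ^ j * (P j * s)       ≤⟨ *-monoʳ-≤ (N ^ j) ratio ⟩
  N ^ j * (P (suc j) * N) ≡⟨ e₃ (N ^ j) (P (suc j)) N ⟩
  N * N ^ j * P (suc j)   ∎
  where
  open ≤-Reasoning
  N = length xs
  s = ∑ xs f
  P : ℕ → ℕ
  P i = ∑ xs λ x → f x ^ i
  e₁ : ∀ a b c → a * (b * c) ≡ a * c * b
  e₁ = solve-∀
  e₂ : ∀ a b c → a * b * c ≡ a * (b * c)
  e₂ = solve-∀
  e₃ : ∀ a b c → a * (b * c) ≡ c * a * b
  e₃ = solve-∀
  convex : ∀ i → P (suc i) * P (suc i) ≤ P (2 + i) * P i * 1
  convex i = begin
    P (suc i) * P (suc i)
      ≡⟨ cong (λ t → t * t) (Sum.fold-cong xs λ x → c₁ (f x) (f x ^ i)) ⟩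
    ∑ xs (λ x → f x ^ i * (f x * 1)) * ∑ xs (λ x → f x ^ i * (f x * 1))
      ≤⟨ cauchy-schwarz xs (λ x → f x ^ i) f (λ _ → 1) ⟩
    ∑ xs (λ x → f x ^ i * (f x * f x)) * ∑ xs (λ x → f x ^ i * 1)
      ≡⟨ cong₂ _*_ (Sum.fold-cong xs λ x → c₂ (f x) (f x ^ i)) (Sum.fold-cong xs λ x → *-identityʳ (f x ^ i)) ⟩
    P (2 + i) * P i ≡⟨ *-identityʳ _ ⟨
    P (2 + i) * P i * 1 ∎
    where
    c₁ : ∀ a b → a * b ≡ b * (a * 1)
    c₁ = solve-∀
    c₂ : ∀ a b → b * (a * a) ≡ a * (a * b)
    c₂ = solve-∀
  ratio : P j * s ≤ P (suc j) * N
  ratio = begin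
    P j * s ≡⟨ cong (P j *_) (Sum.fold-cong xs λ x → *-identityʳ (f x)) ⟨
    P j * P 1 ≤⟨ log-convex⇒ratio P 1 (suc j) (λ i _ → convex i) j ≤-refl ⟩
    P (suc j) * 1 ^ j * P 0
      ≡⟨ cong₂ (λ a b → P (suc j) * a * b) (^-zeroˡ j) (trans (∑-const xs 1) (*-identityʳ N)) ⟩
    P (suc j) * 1 * N ≡⟨ cong (_* N) (*-identityʳ (P (suc j))) ⟩
    P (suc j) * N ∎

-- Edge lists, homomorphism counts and subdivisions

bit : Bool → ℕ
bit b = if b then 1 else 0

-- Restates the private `endpoint` of the subdivision with the edge itself as argument, so that
-- folds over edge indices become folds over `edges H`.
isEnd : Fin n × Fin n → Fin n → Bool
isEnd (a , b) i = ⌊ i ≟ a ⌋ ∨ ⌊ i ≟ b ⌋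

module _ (H : Graph) where
  private
    k = order H
    l = numEdges H
    es = edges H

  -- This and the next three lemmas put the adjacency matrix of the subdivision in block form: zero
  -- blocks on the diagonal, the incidence matrix of `H` off it.
  subdivision-vv : ∀ i j → adj (subdivision H) (i ↑ˡ l) (j ↑ˡ l) ≡ false
  subdivision-vv i j rewrite splitAt-↑ˡ k i l | splitAt-↑ˡ k j l = refl

  subdivision-ve : ∀ i e → adj (subdivision H) (i ↑ˡ l) (k ↑ʳ e) ≡ isEnd (lookup es e) i
  subdivision-ve i e rewrite splitAt-↑ˡ k i l | splitAt-↑ʳ k l e with lookup es e
  ... | _ = refl

  subdivision-ev : ∀ e i → adj (subdivision H) (k ↑ʳ e) (i ↑ˡ l) ≡ isEnd (lookup es e) i
  subdivision-ev e i = trans (adj-sym (subdivision H) (k ↑ʳ e) (i ↑ˡ l)) (subdivision-ve i e)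

  subdivision-ee : ∀ e e′ → adj (subdivision H) (k ↑ʳ e) (k ↑ʳ e′) ≡ false
  subdivision-ee e e′ rewrite splitAt-↑ʳ k l e | splitAt-↑ʳ k l e′ = refl

module EdgeFold {_∙_ : ℕ → ℕ → ℕ} {ε : ℕ} (isCM : IsCommutativeMonoid _≡_ _∙_ ε) where
  open IsCommutativeMonoid isCM using (identityˡ; identityʳ)
  open BigOp isCM
  open ≡-Reasoning

  fold-if : (c : Bool) (x : A) (f : A → ℕ) → fold (if c then [ x ] else []) f ≡ when c (f x)
  fold-if true  x f = identityʳ (f x)
  fold-if false x f = refl

  when-∙ : ∀ c x y → when c x ∙ when c y ≡ when c (x ∙ y)
  when-∙ true  x y = refl
  when-∙ false x y = identityˡ ε

  fold-edges : (H : Graph) (Φ : Fin (order H) × Fin (order H) → ℕ) →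
    fold (edges H) Φ ≡ fold (allFin (order H)) λ a → fold (allFin (order H)) λ b →
      when (⌊ a <? b ⌋ ∧ adj H a b) (Φ (a , b))
  fold-edges H Φ = trans (fold-concatMap _ V Φ) (fold-cong V λ a →
    trans (fold-concatMap _ V Φ) (fold-cong V λ b →
      fold-if (⌊ a <? b ⌋ ∧ adj H a b) (a , b) Φ))
    where V = allFin (order H)

  -- `edges` lists increasing pairs only. The extra hypothesis `a < b` is what `fold-endpoints`
  -- needs to tell the two ends apart.
  fold-edges-cong : (H : Graph) {Φ Ψ : Fin (order H) × Fin (order H) → ℕ} →
    (∀ a b → a Fin.< b → Φ (a , b) ≡ Ψ (a , b)) → fold (edges H) Φ ≡ fold (edges H) Ψ
  fold-edges-cong H {Φ} {Ψ} eq = begin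
    fold (edges H) Φ ≡⟨ fold-edges H Φ ⟩
    _ ≡⟨ fold-cong (allFin _) (λ a → fold-cong (allFin _) λ b → pointwise a b) ⟩
    _ ≡⟨ fold-edges H Ψ ⟨
    fold (edges H) Ψ ∎
    where
    pointwise : ∀ a b →
      when (⌊ a <? b ⌋ ∧ adj H a b) (Φ (a , b)) ≡ when (⌊ a <? b ⌋ ∧ adj H a b) (Ψ (a , b))
    pointwise a b with a <? b
    ... | yes a<b = cong (when (adj H a b)) (eq a b a<b)
    ... | no _    = refl

  -- An ordered adjacent pair is increasing or decreasing, loops being excluded; the decreasing
  -- pairs are folded in with their indices exchanged. The product form turns `isHom` into a product
  -- over edges, the sum form is the handshake lemma.
  fold-adj : (H : Graph) (F : Fin (order H) → Fin (order H) → ℕ) →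
    (fold (allFin (order H)) λ a → fold (allFin (order H)) λ b → when (adj H a b) (F a b))
      ≡ fold (edges H) λ (a , b) → F a b ∙ F b a
  fold-adj H F = begin
    (fold V λ a → fold V λ b → when (adj H a b) (F a b))
      ≡⟨ fold-cong V (λ a → trans (fold-cong V (pointwise a)) (fold-∙ V _ _)) ⟩
    (fold V λ a → fold V (λ b → up a b (F a b)) ∙ fold V (λ b → up b a (F a b)))
      ≡⟨ fold-∙ V _ _ ⟩
    (fold V λ a → fold V λ b → up a b (F a b)) ∙ (fold V λ a → fold V λ b → up b a (F a b))
      ≡⟨ cong ((fold V λ a → fold V λ b → up a b (F a b)) ∙_) (fold-swap V V _) ⟩
    (fold V λ a → fold V λ b → up a b (F a b)) ∙ (fold V λ b → fold V λ a → up b a (F a b))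
      ≡⟨ fold-∙ V _ _ ⟨
    (fold V λ a → fold V (λ b → up a b (F a b)) ∙ fold V (λ b → up a b (F b a)))
      ≡⟨ fold-cong V (λ a → trans (sym (fold-∙ V _ _)) (fold-cong V λ b → when-∙ _ (F a b) (F b a))) ⟩
    (fold V λ a → fold V λ b → up a b (F a b ∙ F b a))
      ≡⟨ fold-edges H _ ⟨
    fold (edges H) (λ (a , b) → F a b ∙ F b a) ∎
    where
    V = allFin (order H)
    up : Fin (order H) → Fin (order H) → ℕ → ℕ
    up a b = when (⌊ a <? b ⌋ ∧ adj H a b)
    pointwise : ∀ a b → when (adj H a b) (F a b) ≡ up a b (F a b) ∙ up b a (F a b)
    pointwise a b with <-cmp a b | a <? b | b <? a
    ... | tri< _ _ _   | yes _ | no _  = sym (identityʳ _)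
    ... | tri> _ _ _   | no _  | yes _ = trans (cong (λ c → when c (F a b)) (adj-sym H a b)) (sym (identityˡ _))
    ... | tri≈ _ refl _ | no _  | no _ = trans (cong (λ c → when c (F a a)) (adj-irr H a)) (sym (identityˡ _))
    ... | tri< p _ _   | no q  | _     = contradiction p q
    ... | tri< _ _ p   | _     | yes q = contradiction q p
    ... | tri> p _ _   | yes q | _     = contradiction q p
    ... | tri> _ _ p   | _     | no q  = contradiction p q
    ... | tri≈ p _ _   | yes q | _     = contradiction q p
    ... | tri≈ _ _ p   | _     | yes q = contradiction q p

  fold-≟ : (a : Fin n) (F : Fin n → ℕ) → fold (allFin n) (λ i → when ⌊ i ≟ a ⌋ (F i)) ≡ F a
  fold-≟ {suc n} zero F = trans (fold-suc (λ i → when ⌊ i ≟ zero ⌋ (F i)))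
    (trans (cong (F zero ∙_) (fold-ε (allFin n))) (identityʳ _))
  fold-≟ {suc n} (suc a) F = trans (fold-suc (λ i → when ⌊ i ≟ suc a ⌋ (F i)))
    (trans (identityˡ _) (trans (fold-cong (allFin n) shift) (fold-≟ a (F ∘ suc))))
    where
    shift : ∀ i → when ⌊ suc i ≟ suc a ⌋ (F (suc i)) ≡ when ⌊ i ≟ a ⌋ (F (suc i))
    -- The two `⌊_⌋` do not agree by computation, but the underlying `does` do.
    shift i = cong (λ p → when p (F (suc i)))
      (trans (isYes≗does (suc i ≟ suc a)) (sym (isYes≗does (i ≟ a))))

  -- As `a` and `b` differ, no index passes both tests, and the `∨` splits into two delta functions.
  fold-endpoints : (a b : Fin n) → a Fin.< b → (F : Fin n → ℕ) →
    fold (allFin n) (λ i → when (⌊ i ≟ a ⌋ ∨ ⌊ i ≟ b ⌋) (F i)) ≡ F a ∙ F b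
  fold-endpoints {n} a b a<b F = begin
    fold (allFin n) (λ i → when (⌊ i ≟ a ⌋ ∨ ⌊ i ≟ b ⌋) (F i))
      ≡⟨ fold-cong (allFin n) pointwise ⟩
    fold (allFin n) (λ i → when ⌊ i ≟ a ⌋ (F i) ∙ when ⌊ i ≟ b ⌋ (F i))
      ≡⟨ fold-∙ (allFin n) _ _ ⟩
    _ ≡⟨ cong₂ _∙_ (fold-≟ a F) (fold-≟ b F) ⟩
    F a ∙ F b ∎
    where
    pointwise : ∀ i → when (⌊ i ≟ a ⌋ ∨ ⌊ i ≟ b ⌋) (F i) ≡ when ⌊ i ≟ a ⌋ (F i) ∙ when ⌊ i ≟ b ⌋ (F i)
    pointwise i with i ≟ a | i ≟ b
    ... | yes refl | yes refl = contradiction refl (Fin-<⇒≢ a<b)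
    ... | yes _    | no _     = sym (identityʳ _)
    ... | no _     | yes _    = sym (identityˡ _)
    ... | no _     | no _     = sym (identityˡ _)

  -- Both index ranges are cut into original and middle vertices. The two diagonal blocks fold to
  -- `ε`, and the mixed blocks remain, one for each order of an incidence.
  fold-subdivision : (H : Graph) → let k = order H; l = numEdges H in
    (F : Fin (k + l) → Fin (k + l) → ℕ) →
    (fold (allFin (k + l)) λ x → fold (allFin (k + l)) λ y → when (adj (subdivision H) x y) (F x y))
      ≡ (fold (allFin l) λ e → fold (allFin k) λ i → when (isEnd (lookup (edges H) e) i) (F (i ↑ˡ l) (k ↑ʳ e)))
      ∙ (fold (allFin l) λ e → fold (allFin k) λ i → when (isEnd (lookup (edges H) e) i) (F (k ↑ʳ e) (i ↑ˡ l)))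
  fold-subdivision H F = begin
    fold (allFin (k + l)) (λ x → fold (allFin (k + l)) (G x))
      ≡⟨ fold-+ k l (λ x → fold (allFin (k + l)) (G x)) ⟩
    fold K (λ i → fold (allFin (k + l)) (G (i ↑ˡ l))) ∙ fold L (λ e → fold (allFin (k + l)) (G (k ↑ʳ e)))
      ≡⟨ cong₂ _∙_
           (fold-cong K λ i → trans (fold-+ k l (G (i ↑ˡ l)))
             (trans (cong (_∙ fold L (λ e → G (i ↑ˡ l) (k ↑ʳ e))) (vv i)) (identityˡ _)))
           (fold-cong L λ e → trans (fold-+ k l (G (k ↑ʳ e)))
             (trans (cong (fold K (λ i → G (k ↑ʳ e) (i ↑ˡ l)) ∙_) (ee e)) (identityʳ _))) ⟩
    fold K (λ i → fold L λ e → G (i ↑ˡ l) (k ↑ʳ e)) ∙ fold L (λ e → fold K λ i → G (k ↑ʳ e) (i ↑ˡ l))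
      ≡⟨ cong₂ _∙_
           (trans (fold-swap K L _) (fold-cong L λ e → fold-cong K λ i →
             cong (λ c → when c (F (i ↑ˡ l) (k ↑ʳ e))) (subdivision-ve H i e)))
           (fold-cong L λ e → fold-cong K λ i →
             cong (λ c → when c (F (k ↑ʳ e) (i ↑ˡ l))) (subdivision-ev H e i)) ⟩
    _ ∎
    where
    k = order H
    l = numEdges H
    K = allFin k
    L = allFin l
    G : Fin (k + l) → Fin (k + l) → ℕ
    G x y = when (adj (subdivision H) x y) (F x y)
    vv : ∀ i → fold K (λ j → G (i ↑ˡ l) (j ↑ˡ l)) ≡ ε
    vv i = trans
      (fold-cong K λ j → cong (λ c → when c (F (i ↑ˡ l) (j ↑ˡ l))) (subdivision-vv H i j))
      (fold-ε K)
    ee : ∀ e → fold L (λ e′ → G (k ↑ʳ e) (k ↑ʳ e′)) ≡ ε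
    ee e = trans
      (fold-cong L λ e′ → cong (λ c → when c (F (k ↑ʳ e) (k ↑ʳ e′))) (subdivision-ee H e e′))
      (fold-ε L)

  -- Vertex `zero` is split off: it is joined to every other vertex, and the rest is a shifted
  -- `complete k`.
  fold-complete-suc : ∀ k (Φ : Fin (suc k) × Fin (suc k) → ℕ) →
    fold (edges (complete (suc k))) Φ
      ≡ fold (allFin k) (λ j → Φ (zero , suc j)) ∙ fold (edges (complete k)) λ (i , j) → Φ (suc i , suc j)
  fold-complete-suc k Φ = begin
    fold (edges (complete (suc k))) Φ
      ≡⟨ trans (fold-edges (complete (suc k)) Φ) (fold-suc (λ i → fold (allFin (suc k)) (c i))) ⟩
    fold (allFin (suc k)) (c zero) ∙ fold (allFin k) (λ i → fold (allFin (suc k)) (c (suc i)))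
      ≡⟨ cong₂ _∙_ (trans (fold-suc (c zero)) (identityˡ _))
           (fold-cong (allFin k) λ i → trans (fold-suc (c (suc i))) (identityˡ _)) ⟩
    fold (allFin k) (λ j → Φ (zero , suc j)) ∙ fold (allFin k) (λ i → fold (allFin k) (λ j → c (suc i) (suc j)))
      ≡⟨ cong (fold (allFin k) (λ j → Φ (zero , suc j)) ∙_)
           (trans (fold-cong (allFin k) λ i → fold-cong (allFin k) (shift i)) (sym (fold-edges (complete k) _))) ⟩
    _ ∎
    where
    c : Fin (suc k) → Fin (suc k) → ℕ
    c i j = when (⌊ i <? j ⌋ ∧ adj (complete (suc k)) i j) (Φ (i , j))
    shift : ∀ i j → c (suc i) (suc j) ≡ when (⌊ i <? j ⌋ ∧ adj (complete k) i j) (Φ (suc i , suc j))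
    shift i j = cong₂ (λ p q → when (p ∧ not q) (Φ (suc i , suc j)))
      (trans (isYes≗does (suc i <? suc j)) (sym (isYes≗does (i <? j))))
      (trans (isYes≗does (suc i ≟ suc j)) (sym (isYes≗does (i ≟ j))))

module SumE = EdgeFold +-0-isCommutativeMonoid
module ProdE = EdgeFold *-1-isCommutativeMonoid

-- Sums over all maps

length-allFin : ∀ n → length (allFin n) ≡ n
length-allFin n = length-tabulate id

∑-allFin-const : ∀ n c → (∑ (allFin n) λ _ → c) ≡ n * c
∑-allFin-const n c = trans (∑-const (allFin n) c) (cong (_* c) (length-allFin n))

length≡∑ : (xs : List A) → length xs ≡ ∑ xs λ _ → 1
length≡∑ xs = sym (trans (∑-const xs 1) (*-identityʳ _))

∑-allMaps-suc : ∀ v n (F : Vec (Fin n) (suc v) → ℕ) →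
  ∑ (allMaps (suc v) n) F ≡ ∑ (allFin n) λ x → ∑ (allMaps v n) λ f → F (x ∷ f)
∑-allMaps-suc v n F = trans (Sum.fold-concatMap _ (allFin n) F)
  (Sum.fold-cong (allFin n) λ x → Sum.fold-map (x ∷_) (allMaps v n) F)

∑-allMaps-+ : ∀ u v n (F : Vec (Fin n) (u + v) → ℕ) →
  ∑ (allMaps (u + v) n) F ≡ ∑ (allMaps u n) λ f → ∑ (allMaps v n) λ g → F (f ++ᵥ g)
∑-allMaps-+ zero    v n F = sym (+-identityʳ _)
∑-allMaps-+ (suc u) v n F = trans (∑-allMaps-suc (u + v) n F)
  (trans (Sum.fold-cong (allFin n) λ x → ∑-allMaps-+ u v n (F ∘ (x ∷_)))
    (sym (∑-allMaps-suc u n λ f → ∑ (allMaps v n) λ g → F (f ++ᵥ g))))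

-- A map into a product is a pair of maps, whence `weightedHom` is multiplicative under `_⊗_`. The
-- two enumerations differ in order, so the equality is one of sums and not of lists.
∑-allMaps-* : ∀ v m n (F : Vec (Fin (m * n)) v → ℕ) →
  ∑ (allMaps v (m * n)) F ≡ ∑ (allMaps v m) λ f → ∑ (allMaps v n) λ g → F (zipWith combine f g)
∑-allMaps-* zero    m n F = sym (+-identityʳ _)
∑-allMaps-* (suc v) m n F = begin
  ∑ (allMaps (suc v) (m * n)) F ≡⟨ ∑-allMaps-suc v (m * n) F ⟩
  _ ≡⟨ Sum.fold-* m n _ ⟩
  (∑ (allFin m) λ x → ∑ (allFin n) λ y → ∑ (allMaps v (m * n)) λ h → F (combine x y ∷ h))
    ≡⟨ Sum.fold-cong (allFin m) (λ x → Sum.fold-cong (allFin n) λ y → ∑-allMaps-* v m n _) ⟩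
  (∑ (allFin m) λ x → ∑ (allFin n) λ y → ∑ (allMaps v m) λ f → ∑ (allMaps v n) λ g → F′ (x ∷ f) (y ∷ g))
    ≡⟨ Sum.fold-cong (allFin m) (λ x → Sum.fold-swap (allFin n) (allMaps v m) _) ⟩
  (∑ (allFin m) λ x → ∑ (allMaps v m) λ f → ∑ (allFin n) λ y → ∑ (allMaps v n) λ g → F′ (x ∷ f) (y ∷ g))
    ≡⟨ Sum.fold-cong (allFin m) (λ x → Sum.fold-cong (allMaps v m) λ f → ∑-allMaps-suc v n _) ⟨
  (∑ (allFin m) λ x → ∑ (allMaps v m) λ f → ∑ (allMaps (suc v) n) λ g → F′ (x ∷ f) g)
    ≡⟨ ∑-allMaps-suc v m _ ⟨
  (∑ (allMaps (suc v) m) λ f → ∑ (allMaps (suc v) n) λ g → F′ f g) ∎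
  where
  open ≡-Reasoning
  F′ : Vec (Fin m) (suc v) → Vec (Fin n) (suc v) → ℕ
  F′ f g = F (zipWith combine f g)

-- Distributivity, in the form that lets the middle vertices of a subdivision choose their images
-- independently.
∑-∏ : ∀ m n (F : Fin m → Fin n → ℕ) →
  (∑ (allMaps m n) λ g → ∏ (allFin m) λ e → F e (lookupᵥ g e)) ≡ ∏ (allFin m) λ e → ∑ (allFin n) (F e)
∑-∏ zero    n F = refl
∑-∏ (suc m) n F = begin
  (∑ (allMaps (suc m) n) λ g → ∏ (allFin (suc m)) λ e → F e (lookupᵥ g e))
    ≡⟨ ∑-allMaps-suc m n _ ⟩
  (∑ (allFin n) λ x → ∑ (allMaps m n) λ g → ∏ (allFin (suc m)) λ e → F e (lookupᵥ (x ∷ g) e))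
    ≡⟨ Sum.fold-cong (allFin n) (λ x → Sum.fold-cong (allMaps m n) λ g →
         Prod.fold-suc (λ e → F e (lookupᵥ (x ∷ g) e))) ⟩
  (∑ (allFin n) λ x → ∑ (allMaps m n) λ g → F zero x * ∏ (allFin m) λ e → F (suc e) (lookupᵥ g e))
    ≡⟨ ∑-*-∑ (allFin n) (allMaps m n) (F zero) _ ⟨
  ∑ (allFin n) (F zero) * (∑ (allMaps m n) λ g → ∏ (allFin m) λ e → F (suc e) (lookupᵥ g e))
    ≡⟨ cong (∑ (allFin n) (F zero) *_) (∑-∏ m n (F ∘ suc)) ⟩
  ∑ (allFin n) (F zero) * (∏ (allFin m) λ e → ∑ (allFin n) (F (suc e)))
    ≡⟨ Prod.fold-suc (λ e → ∑ (allFin n) (F e)) ⟨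
  (∏ (allFin (suc m)) λ e → ∑ (allFin n) (F e)) ∎
  where open ≡-Reasoning

length-allMaps : ∀ v n → length (allMaps v n) ≡ n ^ v
length-allMaps zero    n = refl
length-allMaps (suc v) n = begin
  length (allMaps (suc v) n) ≡⟨ length≡∑ (allMaps (suc v) n) ⟩
  (∑ (allMaps (suc v) n) λ _ → 1) ≡⟨ ∑-allMaps-suc v n _ ⟩
  (∑ (allFin n) λ _ → ∑ (allMaps v n) λ _ → 1) ≡⟨ ∑-allFin-const n _ ⟩
  n * (∑ (allMaps v n) λ _ → 1) ≡⟨ cong (n *_) (length≡∑ (allMaps v n)) ⟨
  n * length (allMaps v n) ≡⟨ cong (n *_) (length-allMaps v n) ⟩
  n * n ^ v ∎
  where open ≡-Reasoning

-- Weighted homomorphism counts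

edgeWeight : List (Fin v × Fin v) → (Fin n → Fin n → ℕ) → Vec (Fin n) v → ℕ
edgeWeight es w f = ∏ es λ (a , b) → w (lookupᵥ f a) (lookupᵥ f b)

-- This is `n ^ v` times the homomorphism density in the weight `w`. Each edge counts once, in its
-- listed orientation, and the diagonal of `w` may be nonzero.
weightedHom : List (Fin v × Fin v) → (Fin n → Fin n → ℕ) → ℕ
weightedHom {v} {n} es w = ∑ (allMaps v n) (edgeWeight es w)

total : (Fin n → Fin n → ℕ) → ℕ
total {n} w = ∑ (allFin n) λ x → ∑ (allFin n) λ y → w x y

adjacency : (G : Graph) → Fin (order G) → Fin (order G) → ℕ
adjacency G x y = bit (adj G x y)

bit-idem : ∀ b → bit b * bit b ≡ bit b
bit-idem true  = refl
bit-idem false = refl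

bit≤1 : ∀ b → bit b ≤ 1
bit≤1 true  = ≤-refl
bit≤1 false = z≤n

bit-and : (bs : List Bool) → bit (and bs) ≡ ∏ bs bit
bit-and []           = refl
bit-and (true ∷ bs)  = trans (bit-and bs) (sym (+-identityʳ _))
bit-and (false ∷ bs) = refl

bit-isHom : (H G : Graph) (f : Vec (Fin (order G)) (order H)) →
  bit (isHom H G f) ≡ ∏ (allFin (order H)) λ i → ∏ (allFin (order H)) λ j →
    Prod.when (adj H i j) (adjacency G (lookupᵥ f i) (lookupᵥ f j))
bit-isHom H G f = trans (bit-and (concatMap row V)) (trans (Prod.fold-concatMap row V bit)
  (Prod.fold-cong V λ i → trans (Prod.fold-map _ V bit)
    (Prod.fold-cong V λ j → implies (adj H i j) _)))
  where
  V = allFin (order H)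
  row : Fin (order H) → List Bool
  row i = map (λ j → not (adj H i j) ∨ adj G (lookupᵥ f i) (lookupᵥ f j)) V
  implies : ∀ b c → bit (not b ∨ c) ≡ Prod.when b (bit c)
  implies true  c = refl
  implies false c = refl

-- `isHom` tests every edge in both orientations; the two equal 0/1 factors collapse to one by
-- `bit-idem`.
homCount-weightedHom : (H G : Graph) → homCount H G ≡ weightedHom (edges H) (adjacency G)
homCount-weightedHom H G = Sum.fold-cong (allMaps (order H) (order G)) λ f →
  trans (bit-isHom H G f) (trans (ProdE.fold-adj H _) (Prod.fold-cong (edges H) λ (a , b) →
    trans (cong (adjacency G (lookupᵥ f a) (lookupᵥ f b) *_) (cong bit (adj-sym G _ _)))
      (bit-idem (adj G (lookupᵥ f a) (lookupᵥ f b)))))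

2*numEdges : (G : Graph) → 2 * numEdges G ≡ total (adjacency G)
2*numEdges G = sym (trans (SumE.fold-adj G λ _ _ → 1) (trans (∑-const (edges G) 2) (*-comm (numEdges G) 2)))


-- Double counting of ordered adjacent pairs: each middle vertex has two neighbours, and each
-- incidence occurs in both orders.
numEdges-subdivision : (H : Graph) → numEdges (subdivision H) ≡ 2 * numEdges H
numEdges-subdivision H = *-cancelˡ-≡ _ _ 2 (begin
  2 * numEdges (subdivision H) ≡⟨ 2*numEdges (subdivision H) ⟩
  total (adjacency (subdivision H)) ≡⟨ SumE.fold-subdivision H (λ _ _ → 1) ⟩
  ends + ends ≡⟨ cong (λ t → t + t) ends≡ ⟩
  numEdges H * 2 + numEdges H * 2 ≡⟨ e (numEdges H) ⟩
  2 * (2 * numEdges H) ∎)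
  where
  open ≡-Reasoning
  ends = ∑ (allFin (numEdges H)) λ e → ∑ (allFin (order H)) λ i → bit (isEnd (lookup (edges H) e) i)
  ends≡ : ends ≡ numEdges H * 2
  ends≡ = begin
    ends ≡⟨ Sum.fold-lookup (edges H) (λ e → ∑ (allFin (order H)) λ i → bit (isEnd e i)) ⟩
    _ ≡⟨ SumE.fold-edges-cong H (λ a b a<b → SumE.fold-endpoints a b a<b λ _ → 1) ⟩
    (∑ (edges H) λ _ → 2) ≡⟨ ∑-const (edges H) 2 ⟩
    numEdges H * 2 ∎
  e : ∀ x → x * 2 + x * 2 ≡ 2 * (2 * x)
  e = solve-∀

gram : (Fin n → Fin m → ℕ) → Fin n → Fin n → ℕ
gram {n} {m} B x y = ∑ (allFin m) λ z → B x z * B y z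

-- The square of the adjacency matrix. Its diagonal holds the degrees, so this weight has loops
-- although `G` has none.
codegree : (G : Graph) → Fin (order G) → Fin (order G) → ℕ
codegree G = gram (adjacency G)

-- A map splits into `f` on original and `g` on middle vertices. For fixed `f` each factor of the
-- weight depends on a single value of `g`, so `∑-∏` applies, and the sum for one edge is the
-- codegree of the images of its ends.
homCount-subdivision : (H G : Graph) → homCount (subdivision H) G ≡ weightedHom (edges H) (codegree G)
homCount-subdivision H G = begin
  homCount (subdivision H) G
    ≡⟨ Sum.fold-cong (allMaps (k + l) N) (bit-isHom (subdivision H) G) ⟩
  _ ≡⟨ ∑-allMaps-+ k l N _ ⟩
  _ ≡⟨ Sum.fold-cong (allMaps k N) (λ f → Sum.fold-cong (allMaps l N) (weight f)) ⟩
  (∑ (allMaps k N) λ f → ∑ (allMaps l N) λ g → ∏ (allFin l) λ e → ends f (lookup (edges H) e) (lookupᵥ g e))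
    ≡⟨ Sum.fold-cong (allMaps k N) (λ f → ∑-∏ l N λ e → ends f (lookup (edges H) e)) ⟩
  (∑ (allMaps k N) λ f → ∏ (allFin l) λ e → ∑ (allFin N) (ends f (lookup (edges H) e)))
    ≡⟨ Sum.fold-cong (allMaps k N) (λ f → Prod.fold-lookup (edges H) λ e → ∑ (allFin N) (ends f e)) ⟩
  (∑ (allMaps k N) λ f → ∏ (edges H) λ e → ∑ (allFin N) (ends f e))
    ≡⟨ Sum.fold-cong (allMaps k N) (λ f → ProdE.fold-edges-cong H λ a b a<b →
         Sum.fold-cong (allFin N) λ z → ProdE.fold-endpoints a b a<b _) ⟩
  weightedHom (edges H) (codegree G) ∎
  where
  open ≡-Reasoning
  k = order H
  l = numEdges H
  N = order G
  ends : Vec (Fin N) k → Fin k × Fin k → Fin N → ℕ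
  ends f e z = ∏ (allFin k) λ i → Prod.when (isEnd e i) (adjacency G (lookupᵥ f i) z)
  pair : ∀ f (g : Vec (Fin N) l) e i → let h = f ++ᵥ g; c = isEnd (lookup (edges H) e) i in
    Prod.when c (adjacency G (lookupᵥ h (i ↑ˡ l)) (lookupᵥ h (k ↑ʳ e)))
      * Prod.when c (adjacency G (lookupᵥ h (k ↑ʳ e)) (lookupᵥ h (i ↑ˡ l)))
    ≡ Prod.when c (adjacency G (lookupᵥ f i) (lookupᵥ g e))
  pair f g e i with isEnd (lookup (edges H) e) i
  ... | false = refl
  ... | true rewrite lookup-++ˡ f g i | lookup-++ʳ f g e =
    trans (cong (adjacency G (lookupᵥ f i) (lookupᵥ g e) *_) (cong bit (adj-sym G _ _)))
      (bit-idem (adj G (lookupᵥ f i) (lookupᵥ g e)))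
  weight : ∀ f g → _ ≡ ∏ (allFin l) λ e → ends f (lookup (edges H) e) (lookupᵥ g e)
  weight f g = begin
    _ ≡⟨ ProdE.fold-subdivision H (λ x y → adjacency G (lookupᵥ (f ++ᵥ g) x) (lookupᵥ (f ++ᵥ g) y)) ⟩
    _ ≡⟨ Prod.fold-∙ (allFin l) _ _ ⟨
    _ ≡⟨ Prod.fold-cong (allFin l) (λ e → trans (sym (Prod.fold-∙ (allFin k) _ _))
           (Prod.fold-cong (allFin k) (pair f g e))) ⟩
    _ ∎

-- Subdivisions of complete graphs

-- The identity `⟨a, B Bᵀ b⟩ = ⟨Bᵀ a, Bᵀ b⟩`, through which the positivity of a Gram matrix enters.
gram-bilinear : (B : Fin n → Fin m → ℕ) (a b : Fin n → ℕ) →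
  (∑ (allFin n) λ x → ∑ (allFin n) λ y → gram B x y * (a x * b y))
    ≡ ∑ (allFin m) λ z → ∑ (allFin n) (λ x → a x * B x z) * ∑ (allFin n) (λ y → b y * B y z)
gram-bilinear {n} {m} B a b = begin
  (∑ V λ x → ∑ V λ y → gram B x y * (a x * b y))
    ≡⟨ Sum.fold-cong V (λ x → Sum.fold-cong V λ y → ∑-* Z _ (a x * b y)) ⟩
  (∑ V λ x → ∑ V λ y → ∑ Z λ z → B x z * B y z * (a x * b y))
    ≡⟨ Sum.fold-cong V (λ x → Sum.fold-swap V Z _) ⟩
  (∑ V λ x → ∑ Z λ z → ∑ V λ y → B x z * B y z * (a x * b y))
    ≡⟨ Sum.fold-swap V Z _ ⟩
  (∑ Z λ z → ∑ V λ x → ∑ V λ y → B x z * B y z * (a x * b y))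
    ≡⟨ Sum.fold-cong Z (λ z → Sum.fold-cong V λ x → Sum.fold-cong V λ y → e (B x z) (B y z) (a x) (b y)) ⟩
  (∑ Z λ z → ∑ V λ x → ∑ V λ y → a x * B x z * (b y * B y z))
    ≡⟨ Sum.fold-cong Z (λ z → ∑-*-∑ V V _ _) ⟨
  _ ∎
  where
  open ≡-Reasoning
  V = allFin n
  Z = allFin m
  e : ∀ p q r s → p * q * (r * s) ≡ r * p * (s * q)
  e = solve-∀

numEdges-complete-suc : ∀ j → numEdges (complete (suc j)) ≡ j + numEdges (complete j)
numEdges-complete-suc j = begin
  numEdges (complete (suc j))      ≡⟨ length≡∑ (edges (complete (suc j))) ⟩
  (∑ (edges (complete (suc j))) λ _ → 1) ≡⟨ SumE.fold-complete-suc j (λ _ → 1) ⟩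
  (∑ (allFin j) λ _ → 1) + (∑ (edges (complete j)) λ _ → 1)
    ≡⟨ cong₂ _+_ (trans (∑-allFin-const j 1) (*-identityʳ j)) (sym (length≡∑ (edges (complete j)))) ⟩
  j + numEdges (complete j) ∎
  where open ≡-Reasoning

2*numEdges-complete : ∀ j → 2 * numEdges (complete (suc j)) ≡ suc j * j
2*numEdges-complete zero    = refl
2*numEdges-complete (suc j) = begin
  2 * numEdges (complete (2 + j))           ≡⟨ cong (2 *_) (numEdges-complete-suc (suc j)) ⟩
  2 * (suc j + numEdges (complete (suc j))) ≡⟨ *-distribˡ-+ 2 (suc j) _ ⟩
  2 * suc j + 2 * numEdges (complete (suc j)) ≡⟨ cong (2 * suc j +_) (2*numEdges-complete j) ⟩
  2 * suc j + suc j * j                     ≡⟨ e j ⟩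
  (2 + j) * suc j ∎
  where
  open ≡-Reasoning
  e : ∀ j → 2 * suc j + suc j * j ≡ (2 + j) * suc j
  e = solve-∀

module Clique (B : Fin n → Fin m → ℕ) where
  private
    V = allFin n
    Z = allFin m

  W : Fin n → Fin n → ℕ
  W = gram B

  rowSum : Fin n → ℕ
  rowSum x = ∑ V (W x)

  -- `rowSum` is `W` applied to the constant vector 1, so the left side is the square of
  -- `⟨Bᵀ a, Bᵀ 1⟩`, and ordinary Cauchy-Schwarz over `Fin m` bounds it.
  gram-cauchy-schwarz : (a : Fin n → ℕ) →
    ∑ V (λ x → a x * rowSum x) * ∑ V (λ x → a x * rowSum x)
      ≤ (∑ V λ x → ∑ V λ y → W x y * (a x * a y)) * total W
  gram-cauchy-schwarz a = begin
    ∑ V (λ x → a x * rowSum x) * ∑ V (λ x → a x * rowSum x)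
      ≡⟨ cong (λ t → t * t) cross ⟩
    ∑ Z (λ z → p z * q z) * ∑ Z (λ z → p z * q z)
      ≤⟨ unweighted-cauchy-schwarz Z p q ⟩
    ∑ Z (λ z → p z * p z) * ∑ Z (λ z → q z * q z)
      ≡⟨ cong₂ _*_ (gram-bilinear B a a) square ⟨
    (∑ V λ x → ∑ V λ y → W x y * (a x * a y)) * total W ∎
    where
    open ≤-Reasoning
    p q : Fin m → ℕ
    p z = ∑ V λ x → a x * B x z
    -- The factor 1 is kept so that `q` is literally the term of `gram-bilinear` for the constant
    -- vector.
    q z = ∑ V λ y → 1 * B y z
    cross : ∑ V (λ x → a x * rowSum x) ≡ ∑ Z (λ z → p z * q z)
    cross = trans
      (Sum.fold-cong V λ x → trans (*-∑ (a x) V (W x)) (Sum.fold-cong V λ y →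
        trans (*-comm (a x) (W x y)) (cong (W x y *_) (sym (*-identityʳ (a x))))))
      (gram-bilinear B a (λ _ → 1))
    square : total W ≡ ∑ Z (λ z → q z * q z)
    square = trans (Sum.fold-cong V λ x → Sum.fold-cong V λ y → sym (*-identityʳ (W x y)))
      (gram-bilinear B (λ _ → 1) (λ _ → 1))

  joinWeight : ∀ {j} → Fin n → Vec (Fin n) j → ℕ
  joinWeight {j} x c = ∏ (allFin j) λ i → W x (lookupᵥ c i)

  -- Recursive, so that the head vertex can be split off with its edges; `edgeWeight-complete` ties
  -- it to `complete j`.
  cliqueWeight : ∀ {j} → Vec (Fin n) j → ℕ
  cliqueWeight []      = 1
  cliqueWeight (x ∷ c) = joinWeight x c * cliqueWeight c

  rowProduct : ∀ {j} → Vec (Fin n) j → ℕ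
  rowProduct []      = 1
  rowProduct (x ∷ c) = rowSum x * rowProduct c

  -- S_j is cliqueSum j (k ∸ j).
  cliqueSum : ℕ → ℕ → ℕ
  cliqueSum j p = ∑ (allMaps j n) λ c → cliqueWeight c * rowProduct c ^ p

  -- In the sum on the left a clique is a head `x` and a tail `c`; under the weight `w c` the tail
  -- gives `rowProduct c` and the sum over heads gives `Q c`. Cauchy-Schwarz over `c` separates
  -- them: the square of `rowProduct c` raises the tail exponent to `2 + p`, and
  -- `gram-cauchy-schwarz` turns the square of `Q c` into a sum over two joined heads.
  cliqueSum-log-convex : ∀ j p →
    cliqueSum (1 + j) (1 + p) * cliqueSum (1 + j) (1 + p)
      ≤ cliqueSum (2 + j) p * cliqueSum j (2 + p) * total W
  cliqueSum-log-convex j p = begin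
    cliqueSum (1 + j) (1 + p) * cliqueSum (1 + j) (1 + p)
      ≡⟨ cong (λ t → t * t) one ⟩
    ∑ C (λ c → w c * (rowProduct c * Q c)) * ∑ C (λ c → w c * (rowProduct c * Q c))
      ≤⟨ cauchy-schwarz C w rowProduct Q ⟩
    ∑ C (λ c → w c * (rowProduct c * rowProduct c)) * ∑ C (λ c → w c * (Q c * Q c))
      ≤⟨ *-mono-≤ (≤-reflexive (Sum.fold-cong C λ c →
           e₀ (cliqueWeight c) (rowProduct c) (rowProduct c ^ p)))
           (∑-mono C λ c → *-monoʳ-≤ (w c) (gram-cauchy-schwarz (a c))) ⟩
    cliqueSum j (2 + p) * ∑ C (λ c → w c * (form c * total W))
      ≡⟨ cong (cliqueSum j (2 + p) *_)
           (trans (Sum.fold-cong C λ c → sym (*-assoc (w c) (form c) (total W))) (sym (∑-* C _ (total W)))) ⟩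
    cliqueSum j (2 + p) * (∑ C (λ c → w c * form c) * total W)
      ≡⟨ cong (λ t → cliqueSum j (2 + p) * (t * total W)) two ⟨
    cliqueSum j (2 + p) * (cliqueSum (2 + j) p * total W)
      ≡⟨ e₃ (cliqueSum j (2 + p)) (cliqueSum (2 + j) p) (total W) ⟩
    cliqueSum (2 + j) p * cliqueSum j (2 + p) * total W ∎
    where
    open ≤-Reasoning
    C = allMaps j n
    w Q form : Vec (Fin n) j → ℕ
    w c = cliqueWeight c * rowProduct c ^ p
    a : Vec (Fin n) j → Fin n → ℕ
    a c x = joinWeight x c * rowSum x ^ p
    Q c = ∑ V λ x → a c x * rowSum x
    form c = ∑ V λ x → ∑ V λ y → W x y * (a c x * a c y)

    e₀ : ∀ x y z → x * z * (y * y) ≡ x * (y * (y * z))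
    e₀ = solve-∀
    e₁ : ∀ g k r d s t → g * k * (r * d * (s * t)) ≡ k * t * (d * (g * s * r))
    e₁ = solve-∀
    e₂ : ∀ x y g h k r s t → x * g * (h * k) * (r * (s * t)) ≡ k * t * (x * (g * r * (h * s)))
    e₂ = solve-∀
    e₃ : ∀ x y z → x * (y * z) ≡ y * x * z
    e₃ = solve-∀

    one : cliqueSum (1 + j) (1 + p) ≡ ∑ C λ c → w c * (rowProduct c * Q c)
    one = begin-equality
      cliqueSum (1 + j) (1 + p) ≡⟨ ∑-allMaps-suc j n _ ⟩
      (∑ V λ x → ∑ C λ c → joinWeight x c * cliqueWeight c * (rowSum x * rowProduct c) ^ suc p)
        ≡⟨ Sum.fold-swap V C _ ⟩
      (∑ C λ c → ∑ V λ x → joinWeight x c * cliqueWeight c * (rowSum x * rowProduct c) ^ suc p)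
        ≡⟨ Sum.fold-cong C (λ c → Sum.fold-cong V (pointwise c)) ⟩
      (∑ C λ c → ∑ V λ x → w c * (rowProduct c * (a c x * rowSum x)))
        ≡⟨ Sum.fold-cong C (λ c → trans (cong (w c *_) (*-∑ (rowProduct c) V _)) (*-∑ (w c) V _)) ⟨
      (∑ C λ c → w c * (rowProduct c * Q c)) ∎
      where
      pointwise : ∀ c x → joinWeight x c * cliqueWeight c * (rowSum x * rowProduct c) ^ suc p
        ≡ w c * (rowProduct c * (a c x * rowSum x))
      pointwise c x = trans
        (cong (λ t → joinWeight x c * cliqueWeight c * (rowSum x * rowProduct c * t))
          (^-distribʳ-* (rowSum x) (rowProduct c) p))
        (e₁ (joinWeight x c) (cliqueWeight c) (rowSum x) (rowProduct c) (rowSum x ^ p) (rowProduct c ^ p))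

    two : cliqueSum (2 + j) p ≡ ∑ C λ c → w c * form c
    two = begin-equality
      cliqueSum (2 + j) p
        ≡⟨ trans (∑-allMaps-suc (suc j) n _) (Sum.fold-cong V λ x → ∑-allMaps-suc j n _) ⟩
      (∑ V λ x → ∑ V λ y → ∑ C λ c → term x y c)
        ≡⟨ Sum.fold-cong V (λ x → Sum.fold-swap V C _) ⟩
      (∑ V λ x → ∑ C λ c → ∑ V λ y → term x y c)
        ≡⟨ Sum.fold-swap V C _ ⟩
      (∑ C λ c → ∑ V λ x → ∑ V λ y → term x y c)
        ≡⟨ Sum.fold-cong C (λ c → Sum.fold-cong V λ x → Sum.fold-cong V λ y → pointwise c x y) ⟩
      (∑ C λ c → ∑ V λ x → ∑ V λ y → w c * (W x y * (a c x * a c y)))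
        ≡⟨ Sum.fold-cong C (λ c → trans (*-∑ (w c) V _) (Sum.fold-cong V λ x → *-∑ (w c) V _)) ⟨
      (∑ C λ c → w c * form c) ∎
      where
      term : Fin n → Fin n → Vec (Fin n) j → ℕ
      term x y c = cliqueWeight (x ∷ y ∷ c) * rowProduct (x ∷ y ∷ c) ^ p
      pointwise : ∀ c x y → term x y c ≡ w c * (W x y * (a c x * a c y))
      pointwise c x y = trans
        (cong₂ (λ s t → s * (joinWeight y c * cliqueWeight c) * t)
          (Prod.fold-suc (λ i → W x (lookupᵥ (y ∷ c) i)))
          (trans (^-distribʳ-* (rowSum x) (rowSum y * rowProduct c) p)
            (cong (rowSum x ^ p *_) (^-distribʳ-* (rowSum y) (rowProduct c) p))))
        (e₂ (W x y) 1 (joinWeight x c) (joinWeight y c) (cliqueWeight c)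
          (rowSum x ^ p) (rowSum y ^ p) (rowProduct c ^ p))

  edgeWeight-complete : ∀ {j} (c : Vec (Fin n) j) → edgeWeight (edges (complete j)) W c ≡ cliqueWeight c
  edgeWeight-complete []      = refl
  edgeWeight-complete (x ∷ c) = trans
    (ProdE.fold-complete-suc _ λ (a , b) → W (lookupᵥ (x ∷ c) a) (lookupᵥ (x ∷ c) b))
    (cong (joinWeight x c *_) (edgeWeight-complete c))

  -- Multiplied by `s ^ E`, it is the `suc k`-th power of `n * s ^ k ≤ n ^ k * S 1`, followed by
  -- `S 1 ^ suc k ≤ S (suc k) * s ^ E`. The exponents match because `k * suc k ≡ 2 * E`.
  clique-bound : ∀ k → n ^ suc k * total W ^ numEdges (complete (suc k))
    ≤ weightedHom (edges (complete (suc k))) W * n ^ (2 * numEdges (complete (suc k)))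
  clique-bound k = cancel {n ^ suc k} (begin
    n ^ suc k * s ^ E * s ^ E            ≡⟨ trans (*-assoc (n ^ suc k) _ _) (cong (n ^ suc k *_) s^E*s^E) ⟩
    n ^ suc k * (s ^ k) ^ suc k          ≡⟨ ^-distribʳ-* n (s ^ k) (suc k) ⟨
    (n * s ^ k) ^ suc k                  ≤⟨ ^-monoˡ-≤ (suc k) mean ⟩
    (n ^ k * S 1) ^ suc k                ≡⟨ ^-distribʳ-* (n ^ k) (S 1) (suc k) ⟩
    (n ^ k) ^ suc k * S 1 ^ suc k        ≤⟨ *-monoʳ-≤ ((n ^ k) ^ suc k) (S-lower (suc k) ≤-refl) ⟩
    (n ^ k) ^ suc k * (S (suc k) * s ^ E) ≡⟨ cong₂ (λ x y → x * (y * s ^ E)) n^2E S-top ⟩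
    n ^ (2 * E) * (hom * s ^ E)          ≡⟨ e (n ^ (2 * E)) hom (s ^ E) ⟩
    hom * n ^ (2 * E) * s ^ E ∎)
    where
    open ≤-Reasoning
    s = total W
    E = numEdges (complete (suc k))
    hom = weightedHom (edges (complete (suc k))) W
    S : ℕ → ℕ
    S j = cliqueSum j (suc k ∸ j)

    e : ∀ x y z → x * (y * z) ≡ y * x * z
    e = solve-∀

    exponent : k * suc k ≡ 2 * E
    exponent = trans (*-comm k (suc k)) (sym (2*numEdges-complete k))

    n^2E : (n ^ k) ^ suc k ≡ n ^ (2 * E)
    n^2E = trans (^-*-assoc n k (suc k)) (cong (n ^_) exponent)

    s^E*s^E : s ^ E * s ^ E ≡ (s ^ k) ^ suc k
    s^E*s^E = begin-equality
      s ^ E * s ^ E    ≡⟨ ^-2* s E ⟨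
      s ^ (2 * E)      ≡⟨ cong (s ^_) exponent ⟨
      s ^ (k * suc k)  ≡⟨ ^-*-assoc s k (suc k) ⟨
      (s ^ k) ^ suc k  ∎

    S-0 : S 0 ≡ 1
    S-0 = cong (λ t → t + 0 + 0) (^-zeroˡ (suc k))

    S-1 : S 1 ≡ ∑ V λ x → rowSum x ^ k
    S-1 = trans (∑-allMaps-suc 0 n _) (Sum.fold-cong V λ x →
      trans (+-identityʳ _) (trans (+-identityʳ _) (cong (_^ k) (*-identityʳ (rowSum x)))))

    S-top : S (suc k) ≡ hom
    S-top = Sum.fold-cong (allMaps (suc k) n) λ c → trans
      (cong (λ i → cliqueWeight c * rowProduct c ^ i) (n∸n≡0 k))
      (trans (*-identityʳ _) (sym (edgeWeight-complete c)))

    mean : n * s ^ k ≤ n ^ k * S 1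
    mean = subst₂ (λ l t → l * s ^ k ≤ l ^ k * t) (length-allFin n) (sym S-1) (power-mean V rowSum k)

    -- With `p = k ∸ suc j`, the exponents `1 + p` and `2 + p` of `cliqueSum-log-convex` are those
    -- in `S (suc j)` and `S j`; the bound on `j` keeps the subtractions from truncating.
    S-convex : ∀ j → 2 + j ≤ suc k → S (suc j) * S (suc j) ≤ S (2 + j) * S j * s
    S-convex j le = subst₂
      (λ p q → cliqueSum (suc j) p * cliqueSum (suc j) p ≤ cliqueSum (2 + j) (k ∸ suc j) * cliqueSum j q * s)
      k∸j (trans (cong suc k∸j) (sym (+-∸-assoc 1 (≤-trans (n≤1+n j) (s≤s⁻¹ le)))))
      (cliqueSum-log-convex j (k ∸ suc j))
      where
      k∸j : suc (k ∸ suc j) ≡ k ∸ j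
      k∸j = sym (+-∸-assoc 1 (s≤s⁻¹ le))

    -- The ratio bounds `S i * S 1 ≤ S (suc i) * s ^ i` are multiplied over `i < j`, using
    -- `S 0 ≡ 1`; the exponents add up to the edge number of `complete j`.
    S-lower : ∀ j → j ≤ suc k → S 1 ^ j ≤ S j * s ^ numEdges (complete j)
    S-lower zero    _  = ≤-reflexive (sym (trans (*-identityʳ (S 0)) S-0))
    S-lower (suc j) le = begin
      S 1 * S 1 ^ j                   ≤⟨ *-monoʳ-≤ (S 1) (S-lower j (≤-trans (n≤1+n j) le)) ⟩
      S 1 * (S j * s ^ Eⱼ)            ≡⟨ e₁ (S 1) (S j) (s ^ Eⱼ) ⟩
      S j * S 1 * s ^ Eⱼ              ≤⟨ *-monoˡ-≤ (s ^ Eⱼ) (log-convex⇒ratio S s (suc k) S-convex j le) ⟩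
      S (suc j) * s ^ j * S 0 * s ^ Eⱼ ≡⟨ cong (λ t → S (suc j) * s ^ j * t * s ^ Eⱼ) S-0 ⟩
      S (suc j) * s ^ j * 1 * s ^ Eⱼ  ≡⟨ e₂ (S (suc j)) (s ^ j) (s ^ Eⱼ) ⟩
      S (suc j) * (s ^ j * s ^ Eⱼ)    ≡⟨ cong (S (suc j) *_) (^-distribˡ-+-* s j Eⱼ) ⟨
      S (suc j) * s ^ (j + Eⱼ)        ≡⟨ cong (λ t → S (suc j) * s ^ t) (numEdges-complete-suc j) ⟨
      S (suc j) * s ^ numEdges (complete (suc j)) ∎
      where
      Eⱼ = numEdges (complete j)
      e₁ : ∀ x y z → x * (y * z) ≡ y * x * z
      e₁ = solve-∀
      e₂ : ∀ x y z → x * y * 1 * z ≡ x * (y * z)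
      e₂ = solve-∀

    cancel : ∀ {x y} → x * s ^ E * s ^ E ≤ y * s ^ E → x * s ^ E ≤ y
    cancel {x} {y} le with s ^ E
    -- If `s ^ E` vanishes, so does the left side of the goal.
    ... | zero  = ≤-trans (≤-reflexive (*-zeroʳ x)) z≤n
    ... | suc t = *-cancelʳ-≤ (x * suc t) y (suc t) le

-- Exponential against polynomial growth

n<2^n : ∀ n → n < 2 ^ n
n<2^n zero    = ≤-refl
n<2^n (suc n) = begin
  2 + n               ≤⟨ s≤s (m≤m+n (suc n) n) ⟩
  suc (suc n + n)     ≡⟨ cong suc (+-comm (suc n) n) ⟩
  suc (n + suc n)     ≤⟨ +-mono-≤ (n<2^n n) (n<2^n n) ⟩
  2 ^ n + 2 ^ n       ≡⟨ cong (2 ^ n +_) (+-identityʳ _) ⟨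
  2 * 2 ^ n ∎
  where open ≤-Reasoning

2^r≰[a+r]*m : ∀ a m → ∃ λ r → (a + r) * m < 2 ^ r
2^r≰[a+r]*m a m = r , (begin-strict
  (a + r) * m         ≤⟨ *-mono-≤ (+-monoˡ-≤ r (≤-trans (m≤m+n a m) (n≤1+n _))) (≤-trans (m≤n+m m a) (n≤1+n _)) ⟩
  (w + r) * w         ≡⟨ e₁ w ⟩
  6 * (w * w)         <⟨ *-monoˡ-< (w * w) {6} {8} (s≤s (s≤s (s≤s (s≤s (s≤s (s≤s (s≤s z≤n))))))) ⟩
  8 * (w * w)         ≤⟨ *-mono-≤ eight (*-mono-≤ (<⇒≤ (n<2^n w)) (<⇒≤ (n<2^n w))) ⟩
  2 ^ (3 * w) * (2 ^ w * 2 ^ w) ≡⟨ cong (2 ^ (3 * w) *_) (^-distribˡ-+-* 2 w w) ⟨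
  2 ^ (3 * w) * 2 ^ (w + w)     ≡⟨ ^-distribˡ-+-* 2 (3 * w) (w + w) ⟨
  2 ^ r ∎)
  where
  open ≤-Reasoning
  w = suc (a + m)
  -- The left side is at most `6 * (w * w)`. In `2 ^ r` the summand `3 * w` supplies the factor 8
  -- and each remaining `w` a factor of at least `w`.
  r = 3 * w + (w + w)
  e₁ : ∀ w → (w + (3 * w + (w + w))) * w ≡ 6 * (w * w)
  e₁ = solve-∀
  eight : 8 ≤ 2 ^ (3 * w)
  eight = ^-monoʳ-≤ 2 {3} {3 * w} (*-monoʳ-≤ 3 (s≤s z≤n))

-- With the witness `j = 2 ^ r`, `D * suc j` is at most `2 ^ (D * 2 + r)`, and comparing exponents
-- of 2 leaves a linear function of `r` against `2 ^ r`.
exponential≰polynomial : ∀ D m → ∃ λ j → (D * suc j) ^ m < 2 ^ j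
exponential≰polynomial D m with 2^r≰[a+r]*m (D * 2) m
... | r , lt = 2 ^ r , (begin-strict
  (D * suc (2 ^ r)) ^ m       ≤⟨ ^-monoˡ-≤ m base ⟩
  (2 ^ (D * 2 + r)) ^ m       ≡⟨ ^-*-assoc 2 (D * 2 + r) m ⟩
  2 ^ ((D * 2 + r) * m)       <⟨ ^-monoʳ-< 2 ≤-refl lt ⟩
  2 ^ (2 ^ r) ∎)
  where
  open ≤-Reasoning
  base : D * suc (2 ^ r) ≤ 2 ^ (D * 2 + r)
  base = begin
    D * suc (2 ^ r)       ≤⟨ *-monoʳ-≤ D (+-monoˡ-≤ (2 ^ r) (m^n>0 2 r)) ⟩
    D * (2 ^ r + 2 ^ r)   ≡⟨ e D (2 ^ r) ⟩
    D * 2 * 2 ^ r         ≤⟨ *-monoˡ-≤ (2 ^ r) (<⇒≤ (n<2^n (D * 2))) ⟩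
    2 ^ (D * 2) * 2 ^ r   ≡⟨ ^-distribˡ-+-* 2 (D * 2) r ⟨
    2 ^ (D * 2 + r) ∎
    where
    e : ∀ x y → x * (y + y) ≡ x * 2 * y
    e = solve-∀

-- Bernoulli's inequality `1 + k / x ≤ (1 + 1 / x) ^ k`, multiplied by `x ^ (k + 1)`.
bernoulli : ∀ x k → x ^ k * (x + k) ≤ x * suc x ^ k
bernoulli x zero    = ≤-reflexive (e x)
  where
  e : ∀ x → 1 * (x + 0) ≡ x * 1
  e = solve-∀
bernoulli x (suc k) = begin
  x * x ^ k * (x + suc k)             ≤⟨ m≤m+n _ (x ^ k * k) ⟩
  x * x ^ k * (x + suc k) + x ^ k * k ≡⟨ e₁ x (x ^ k) k ⟩
  x ^ k * (x + k) * suc x             ≤⟨ *-monoˡ-≤ (suc x) (bernoulli x k) ⟩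
  x * suc x ^ k * suc x               ≡⟨ e₂ x (suc x ^ k) ⟩
  x * (suc x * suc x ^ k) ∎
  where
  open ≤-Reasoning
  e₁ : ∀ x y k → x * y * (x + suc k) + y * k ≡ y * (x + k) * suc x
  e₁ = solve-∀
  e₂ : ∀ x y → x * y * suc x ≡ x * (suc x * y)
  e₂ = solve-∀

-- Bernoulli at `k = x`. It amplifies the smallest integer gap, from `x` to `suc x`, to a factor 2.
2*x^x≤[1+x]^x : ∀ x .{{_ : NonZero x}} → 2 * x ^ x ≤ suc x ^ x
2*x^x≤[1+x]^x x = *-cancelˡ-≤ x (≤-trans (≤-reflexive (e x (x ^ x))) (bernoulli x x))
  where
  e : ∀ x y → x * (2 * y) ≡ y * (x + x)
  e = solve-∀

-- A polynomial loss in k disappears after taking k-th roots.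
power-trick : ∀ c l m x y → (∀ k → y ^ k ≤ (c * suc (k * l)) ^ m * x ^ k) → y ≤ x
power-trick c l m x y le with y ≤? x
... | yes y≤x = y≤x
-- The amplification needs `x` nonzero; for `x = 0` exponent 1 already gives `y ≤ 0`.
power-trick c l m zero y le | no y≰x = contradiction
  (subst₂ _≤_ (*-identityʳ y) (*-zeroʳ ((c * suc (1 * l)) ^ m)) (le 1)) y≰x
power-trick c l m x@(suc _) y le | no y≰x with exponential≰polynomial (c * suc (x * l)) m
-- The hypothesis is taken at exponent `x * j`: as `y ≥ suc x`, each `x`-th power gains a factor 2,
-- hence `2 ^ j` in all, while the loss stays polynomial in `j`.
... | j , lt = contradiction lt (≤⇒≯ (*-cancelʳ-≤ (2 ^ j) _ (x ^ (x * j)) {{m^n≢0 x (x * j)}} (begin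
  2 ^ j * x ^ (x * j)                       ≡⟨ cong (2 ^ j *_) (^-*-assoc x x j) ⟨
  2 ^ j * (x ^ x) ^ j                       ≡⟨ ^-distribʳ-* 2 (x ^ x) j ⟨
  (2 * x ^ x) ^ j                           ≤⟨ ^-monoˡ-≤ j (≤-trans (2*x^x≤[1+x]^x x) (^-monoˡ-≤ x (≰⇒> y≰x))) ⟩
  (y ^ x) ^ j                               ≡⟨ ^-*-assoc y x j ⟩
  y ^ (x * j)                               ≤⟨ le (x * j) ⟩
  (c * suc (x * j * l)) ^ m * x ^ (x * j)   ≤⟨ *-monoˡ-≤ (x ^ (x * j)) (^-monoˡ-≤ m loss) ⟩
  (c * suc (x * l) * suc j) ^ m * x ^ (x * j) ∎)))
  where
  open ≤-Reasoning
  loss : c * suc (x * j * l) ≤ c * suc (x * l) * suc j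
  loss = begin
    c * suc (x * j * l)              ≤⟨ *-monoʳ-≤ c (m≤m+n _ (x * l + j)) ⟩
    c * (suc (x * j * l) + (x * l + j)) ≡⟨ e c x l j ⟩
    c * suc (x * l) * suc j ∎
    where
    e : ∀ c x l j → c * (suc (x * j * l) + (x * l + j)) ≡ c * suc (x * l) * suc j
    e = solve-∀

-- Tensor products

infixr 7 _⊗_
_⊗_ : (Fin m → Fin m → ℕ) → (Fin n → Fin n → ℕ) → Fin (m * n) → Fin (m * n) → ℕ
_⊗_ {m} {n} w w′ p q =
  w (proj₁ (remQuot {m} n p)) (proj₁ (remQuot {m} n q))
    * w′ (proj₂ (remQuot {m} n p)) (proj₂ (remQuot {m} n q))

⊗-combine : (w : Fin m → Fin m → ℕ) (w′ : Fin n → Fin n → ℕ) → ∀ i j i′ j′ →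
  (w ⊗ w′) (combine i j) (combine i′ j′) ≡ w i i′ * w′ j j′
⊗-combine w w′ i j i′ j′ =
  cong₂ (λ p q → w (proj₁ p) (proj₁ q) * w′ (proj₂ p) (proj₂ q)) (remQuot-combine i j) (remQuot-combine i′ j′)

total-⊗ : (w : Fin m → Fin m → ℕ) (w′ : Fin n → Fin n → ℕ) → total (w ⊗ w′) ≡ total w * total w′
total-⊗ {m} {n} w w′ = begin
  total (w ⊗ w′)
    ≡⟨ trans (Sum.fold-cong (allFin (m * n)) λ p → Sum.fold-* m n ((w ⊗ w′) p)) (Sum.fold-* m n _) ⟩
  (∑ M λ i → ∑ N λ j → ∑ M λ i′ → ∑ N λ j′ → (w ⊗ w′) (combine i j) (combine i′ j′))
    ≡⟨ Sum.fold-cong M (λ i → Sum.fold-cong N λ j → trans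
         (Sum.fold-cong M λ i′ → Sum.fold-cong N λ j′ → ⊗-combine w w′ i j i′ j′)
         (sym (∑-*-∑ M N (w i) (w′ j)))) ⟩
  (∑ M λ i → ∑ N λ j → ∑ M (w i) * ∑ N (w′ j))
    ≡⟨ ∑-*-∑ M N _ _ ⟨
  total w * total w′ ∎
  where
  open ≡-Reasoning
  M = allFin m
  N = allFin n

weightedHom-⊗ : (es : List (Fin v × Fin v)) (w : Fin m → Fin m → ℕ) (w′ : Fin n → Fin n → ℕ) →
  weightedHom es (w ⊗ w′) ≡ weightedHom es w * weightedHom es w′
weightedHom-⊗ {v} {m} {n} es w w′ = begin
  weightedHom es (w ⊗ w′) ≡⟨ ∑-allMaps-* v m n _ ⟩
  (∑ (allMaps v m) λ f → ∑ (allMaps v n) λ g → edgeWeight es (w ⊗ w′) (zipWith combine f g))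
    ≡⟨ Sum.fold-cong (allMaps v m) (λ f → Sum.fold-cong (allMaps v n) λ g →
         trans (Prod.fold-cong es λ (a , b) → pointwise f g a b) (Prod.fold-∙ es _ _)) ⟩
  (∑ (allMaps v m) λ f → ∑ (allMaps v n) λ g → edgeWeight es w f * edgeWeight es w′ g)
    ≡⟨ ∑-*-∑ (allMaps v m) (allMaps v n) _ _ ⟨
  weightedHom es w * weightedHom es w′ ∎
  where
  open ≡-Reasoning
  pointwise : ∀ f g a b →
    (w ⊗ w′) (lookupᵥ (zipWith combine f g) a) (lookupᵥ (zipWith combine f g) b)
      ≡ w (lookupᵥ f a) (lookupᵥ f b) * w′ (lookupᵥ g a) (lookupᵥ g b)
  pointwise f g a b = trans
    (cong₂ (w ⊗ w′) (lookup-zipWith combine a f g) (lookup-zipWith combine b f g))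
    (⊗-combine w w′ _ _ _ _)

weightedHom-mono : (es : List (Fin v × Fin v)) {w w′ : Fin n → Fin n → ℕ} →
  (∀ x y → w x y ≤ w′ x y) → weightedHom es w ≤ weightedHom es w′
weightedHom-mono {v} {n} es le = ∑-mono (allMaps v n) λ f → ∏-mono es λ (a , b) → le (lookupᵥ f a) (lookupᵥ f b)

weightedHom-1 : (es : List (Fin v × Fin v)) → weightedHom {n = n} es (λ _ _ → 1) ≡ n ^ v
weightedHom-1 {v} {n} es = trans (Sum.fold-cong (allMaps v n) λ _ → Prod.fold-ε es)
  (trans (sym (length≡∑ (allMaps v n))) (length-allMaps v n))

weightedHom-scale : (es : List (Fin v × Fin v)) (c : ℕ) (w : Fin n → Fin n → ℕ) →
  weightedHom es (λ x y → c * w x y) ≡ c ^ length es * weightedHom es w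
weightedHom-scale {v} {n} es c w = trans
  (Sum.fold-cong (allMaps v n) λ f → trans (Prod.fold-∙ es _ _) (cong (_* edgeWeight es w f) (∏-const es c)))
  (sym (*-∑ (c ^ length es) (allMaps v n) _))

tensorPower : (Fin n → Fin n → ℕ) → ∀ k → Fin (n ^ k) → Fin (n ^ k) → ℕ
tensorPower w zero    = λ _ _ → 1
tensorPower w (suc k) = w ⊗ tensorPower w k

total-tensorPower : (w : Fin n → Fin n → ℕ) → ∀ k → total (tensorPower w k) ≡ total w ^ k
total-tensorPower w zero    = refl
total-tensorPower w (suc k) =
  trans (total-⊗ w (tensorPower w k)) (cong (total w *_) (total-tensorPower w k))

weightedHom-tensorPower : (es : List (Fin v × Fin v)) (w : Fin n → Fin n → ℕ) → ∀ k →
  weightedHom es (tensorPower w k) ≡ weightedHom es w ^ k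
weightedHom-tensorPower {v} es w zero = trans (weightedHom-1 {n = 1} es) (^-zeroˡ v)
weightedHom-tensorPower es w (suc k) =
  trans (weightedHom-⊗ es w (tensorPower w k)) (cong (weightedHom es w *_) (weightedHom-tensorPower es w k))

tensorPower-sym : (w : Fin n → Fin n → ℕ) → (∀ x y → w x y ≡ w y x) →
  ∀ k p q → tensorPower w k p q ≡ tensorPower w k q p
tensorPower-sym w w-sym zero    p q = refl
tensorPower-sym w w-sym (suc k) p q = cong₂ _*_ (w-sym _ _) (tensorPower-sym w w-sym k _ _)

-- The exponent grows only linearly in `k`, and so does the number of dyadic levels; this makes the
-- loss polynomial.
tensorPower-≤ : (w : Fin n → Fin n → ℕ) (l : ℕ) → (∀ x y → w x y ≤ 2 ^ l) →
  ∀ k p q → tensorPower w k p q ≤ 2 ^ (k * l)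
tensorPower-≤ w l w≤ zero    p q = ≤-refl
tensorPower-≤ w l w≤ (suc k) p q = ≤-trans
  (*-mono-≤ (w≤ _ _) (tensorPower-≤ w l w≤ k _ _))
  (≤-reflexive (sym (^-distribˡ-+-* 2 l (k * l))))

-- Tensoring with K₂ removes the loops of a relation.
doubleCover : (R : Fin n → Fin n → Bool) → (∀ x y → R x y ≡ R y x) → Graph
doubleCover {n} R R-sym = record
  { order   = n * 2
  ; adj     = λ p q → R (base p) (base q) ∧ adj (complete 2) (sheet p) (sheet q)
  ; adj-sym = λ p q → cong₂ _∧_ (R-sym (base p) (base q)) (adj-sym (complete 2) (sheet p) (sheet q))
  ; adj-irr = λ p → trans (cong (R (base p) (base p) ∧_) (adj-irr (complete 2) (sheet p))) (∧-zeroʳ _)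
  }
  where
  base : Fin (n * 2) → Fin n
  base p = proj₁ (remQuot {n} 2 p)
  sheet : Fin (n * 2) → Fin 2
  sheet p = proj₂ (remQuot {n} 2 p)

adjacency-doubleCover : (R : Fin n → Fin n → Bool) (R-sym : ∀ x y → R x y ≡ R y x) →
  ∀ p q → adjacency (doubleCover R R-sym) p q ≡ ((λ x y → bit (R x y)) ⊗ adjacency (complete 2)) p q
adjacency-doubleCover {n} R R-sym p q = bit-∧ (R _ _) _
  where
  bit-∧ : ∀ b c → bit (b ∧ c) ≡ bit b * bit c
  bit-∧ true  c = sym (+-identityʳ _)
  bit-∧ false c = refl

-- Dyadic level sets and Sidorenko's inequality for weights

threshold : ℕ → ℕ → ℕ
threshold y i = bit ⌊ 2 ^ i ≤? y ⌋

2^i*threshold≤y : ∀ y i → 2 ^ i * threshold y i ≤ y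
2^i*threshold≤y y i with 2 ^ i ≤? y
... | yes le = ≤-trans (≤-reflexive (*-identityʳ (2 ^ i))) le
... | no _   = ≤-trans (≤-reflexive (*-zeroʳ (2 ^ i))) z≤n

-- For positive `y` the term of the largest `i` with `2 ^ i ≤ y` suffices, since `y < 2 * 2 ^ i`.
y≤∑threshold : ∀ L y → y < 2 ^ L → y ≤ ∑ (downFrom L) λ i → 2 * (2 ^ i * threshold y i)
y≤∑threshold zero    zero _ = z≤n
y≤∑threshold zero    (suc y) (s≤s ())
y≤∑threshold (suc L) y y<2^ with 2 ^ L ≤? y
... | yes _  = ≤-trans (<⇒≤ y<2^) (≤-trans
  (≤-reflexive (cong (2 *_) (sym (*-identityʳ (2 ^ L))))) (m≤m+n _ _))
... | no 2^≰y = ≤-trans (y≤∑threshold L y (≰⇒> 2^≰y)) (m≤n+m _ _)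

module _ (H : Graph) (sidorenko : Sidorenko H) where
  private
    v′ = order H
    m′ = numEdges H
    es = edges H

  -- The hypothesis on `H` is applied to the double cover, which has `n * 2` vertices and degree sum
  -- `t * 2`. This puts `2 ^ v′ * 2 ^ m′` on the left and at most `2 ^ v′ * 2 ^ (2 * m′)` on the
  -- right; the factor `2 ^ m′` is the difference.
  sidorenko-relation : (R : Fin n → Fin n → Bool) → (∀ x y → R x y ≡ R y x) →
    let w = λ x y → bit (R x y) in
    n ^ v′ * total w ^ m′ ≤ 2 ^ m′ * (weightedHom es w * n ^ (2 * m′))
  sidorenko-relation {n} R R-sym = *-cancelʳ-≤ _ _ (2 ^ v′ * 2 ^ m′)
    {{m*n≢0 _ _ {{m^n≢0 2 v′}} {{m^n≢0 2 m′}}}} (begin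
    n ^ v′ * t ^ m′ * (2 ^ v′ * 2 ^ m′)
      ≡⟨ e₁ (n ^ v′) (t ^ m′) (2 ^ v′) (2 ^ m′) ⟩
    n ^ v′ * 2 ^ v′ * (t ^ m′ * 2 ^ m′)
      ≡⟨ cong₂ _*_ (^-distribʳ-* n 2 v′) (^-distribʳ-* t 2 m′) ⟨
    (n * 2) ^ v′ * (t * 2) ^ m′
      ≡⟨ cong (λ d → (n * 2) ^ v′ * d ^ m′) degrees ⟨
    (n * 2) ^ v′ * (2 * numEdges Γ) ^ m′
      ≤⟨ sidorenko Γ ⟩
    homCount H Γ * (n * 2) ^ (2 * m′)
      ≤⟨ *-mono-≤ homs (≤-reflexive blowup) ⟩
    weightedHom es w * 2 ^ v′ * (n ^ (2 * m′) * (2 ^ m′ * 2 ^ m′))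
      ≡⟨ e₂ (weightedHom es w) (2 ^ v′) (n ^ (2 * m′)) (2 ^ m′) ⟩
    2 ^ m′ * (weightedHom es w * n ^ (2 * m′)) * (2 ^ v′ * 2 ^ m′) ∎)
    where
    open ≤-Reasoning
    w : Fin n → Fin n → ℕ
    w x y = bit (R x y)
    t = total w
    Γ = doubleCover R R-sym
    e₁ : ∀ a b c d → a * b * (c * d) ≡ a * c * (b * d)
    e₁ = solve-∀
    e₂ : ∀ a b c d → a * b * (c * (d * d)) ≡ d * (a * c) * (b * d)
    e₂ = solve-∀
    degrees : 2 * numEdges Γ ≡ t * 2
    degrees = trans (2*numEdges Γ) (trans
      (Sum.fold-cong (allFin (n * 2)) λ p → Sum.fold-cong (allFin (n * 2)) λ q → adjacency-doubleCover R R-sym p q)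
      (total-⊗ w (adjacency (complete 2))))
    homs : homCount H Γ ≤ weightedHom es w * 2 ^ v′
    homs = begin
      homCount H Γ ≡⟨ homCount-weightedHom H Γ ⟩
      weightedHom es (adjacency Γ)
        ≤⟨ weightedHom-mono es (λ p q → ≤-reflexive (adjacency-doubleCover R R-sym p q)) ⟩
      weightedHom es (w ⊗ adjacency (complete 2)) ≡⟨ weightedHom-⊗ es w (adjacency (complete 2)) ⟩
      weightedHom es w * weightedHom es (adjacency (complete 2))
        -- Homomorphisms to `complete 2` are bounded crudely by all maps.
        ≤⟨ *-monoʳ-≤ (weightedHom es w) (weightedHom-mono es λ x y → bit≤1 (adj (complete 2) x y)) ⟩
      weightedHom es w * weightedHom {n = 2} es (λ _ _ → 1)
        ≡⟨ cong (weightedHom es w *_) (weightedHom-1 es) ⟩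
      weightedHom es w * 2 ^ v′ ∎
    blowup : (n * 2) ^ (2 * m′) ≡ n ^ (2 * m′) * (2 ^ m′ * 2 ^ m′)
    blowup = trans (^-distribʳ-* n 2 (2 * m′)) (cong (n ^ (2 * m′) *_)
      (^-2* 2 m′))

  -- The power mean inequality over the `suc L` levels moves the `m′`-th power inside the sum, at
  -- the cost `suc L ^ m′`. Each level obeys `sidorenko-relation`, and scaled by `2 ^ i` lies below
  -- `w`. In `4 ^ m′`, one `2 ^ m′` comes from dyadic rounding, the other from the double cover.
  sidorenko-bounded : (w : Fin n → Fin n → ℕ) → (∀ x y → w x y ≡ w y x) →
    ∀ L → (∀ x y → w x y ≤ 2 ^ L) →
    n ^ v′ * total w ^ m′ ≤ (4 * suc L) ^ m′ * (weightedHom es w * n ^ (2 * m′))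
  sidorenko-bounded {n} w w-sym L w≤ = *-cancelˡ-≤ (suc L) (begin
    suc L * (n ^ v′ * total w ^ m′)
      ≤⟨ *-monoʳ-≤ (suc L) (*-monoʳ-≤ (n ^ v′) (^-monoˡ-≤ m′ total≤)) ⟩
    suc L * (n ^ v′ * ∑ I f ^ m′)   ≡⟨ e₁ (suc L) (n ^ v′) (∑ I f ^ m′) ⟩
    n ^ v′ * (suc L * ∑ I f ^ m′)   ≤⟨ *-monoʳ-≤ (n ^ v′) mean ⟩
    n ^ v′ * (suc L ^ m′ * ∑ I (λ i → f i ^ m′)) ≡⟨ e₁ (n ^ v′) (suc L ^ m′) _ ⟩
    suc L ^ m′ * (n ^ v′ * ∑ I (λ i → f i ^ m′)) ≡⟨ cong (suc L ^ m′ *_) (*-∑ (n ^ v′) I _) ⟩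
    suc L ^ m′ * ∑ I (λ i → n ^ v′ * f i ^ m′) ≤⟨ *-monoʳ-≤ (suc L ^ m′) (∑-mono I level) ⟩
    suc L ^ m′ * ∑ I (λ _ → 4 ^ m′ * X)
      ≡⟨ cong (suc L ^ m′ *_) (trans (∑-const I _) (cong (_* (4 ^ m′ * X)) length-I)) ⟩
    suc L ^ m′ * (suc L * (4 ^ m′ * X)) ≡⟨ e₂ (suc L ^ m′) (suc L) (4 ^ m′) X ⟩
    suc L * (4 ^ m′ * suc L ^ m′ * X) ≡⟨ cong (λ z → suc L * (z * X)) (^-distribʳ-* 4 (suc L) m′) ⟨
    suc L * ((4 * suc L) ^ m′ * X) ∎)
    where
    open ≤-Reasoning
    V = allFin n
    -- The levels run from 0 to `L` inclusive, because `w` may attain `2 ^ L`.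
    I = downFrom (suc L)
    X = weightedHom es w * n ^ (2 * m′)
    level-set : ℕ → Fin n → Fin n → ℕ
    level-set i x y = threshold (w x y) i
    f : ℕ → ℕ
    f i = 2 * (2 ^ i * total (level-set i))
    e₁ : ∀ a b c → a * (b * c) ≡ b * (a * c)
    e₁ = solve-∀
    e₂ : ∀ a b c d → a * (b * (c * d)) ≡ b * (c * a * d)
    e₂ = solve-∀
    e₃ : ∀ a b c d e → b * c * (a * (d * e)) ≡ b * a * (c * d * e)
    e₃ = solve-∀
    length-I : length I ≡ suc L
    length-I = length-downFrom (suc L)
    mean : suc L * ∑ I f ^ m′ ≤ suc L ^ m′ * ∑ I (λ i → f i ^ m′)
    mean = subst (λ l → l * ∑ I f ^ m′ ≤ l ^ m′ * ∑ I (λ i → f i ^ m′)) length-I (power-mean I f m′)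
    total≤ : total w ≤ ∑ I f
    total≤ = begin
      total w
        ≤⟨ ∑-mono V (λ x → ∑-mono V λ y → y≤∑threshold (suc L) (w x y)
             (≤-trans (s≤s (w≤ x y)) (^-monoʳ-< 2 ≤-refl (≤-refl {suc L})))) ⟩
      (∑ V λ x → ∑ V λ y → ∑ I λ i → 2 * (2 ^ i * level-set i x y))
        ≡⟨ trans (Sum.fold-cong V λ x → Sum.fold-swap V I _) (Sum.fold-swap V I _) ⟩
      (∑ I λ i → ∑ V λ x → ∑ V λ y → 2 * (2 ^ i * level-set i x y))
        ≡⟨ Sum.fold-cong I (λ i → trans (Sum.fold-cong V λ x → scale i V (level-set i x)) (scale i V _)) ⟩
      ∑ I f ∎
      where
      scale : ∀ i (xs : List (Fin n)) g → ∑ xs (λ x → 2 * (2 ^ i * g x)) ≡ 2 * (2 ^ i * ∑ xs g)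
      scale i xs g = sym (trans (cong (2 *_) (*-∑ (2 ^ i) xs g)) (*-∑ 2 xs _))
    level : ∀ i → n ^ v′ * f i ^ m′ ≤ 4 ^ m′ * X
    level i = begin
      n ^ v′ * f i ^ m′
        ≡⟨ cong (n ^ v′ *_) (trans (^-distribʳ-* 2 _ m′) (cong (2 ^ m′ *_) (^-distribʳ-* (2 ^ i) _ m′))) ⟩
      n ^ v′ * (2 ^ m′ * ((2 ^ i) ^ m′ * total (level-set i) ^ m′))
        ≡⟨ e₄ (n ^ v′) (2 ^ m′) ((2 ^ i) ^ m′) (total (level-set i) ^ m′) ⟩
      2 ^ m′ * (2 ^ i) ^ m′ * (n ^ v′ * total (level-set i) ^ m′)
        ≤⟨ *-monoʳ-≤ (2 ^ m′ * (2 ^ i) ^ m′) (sidorenko-relation (λ x y → ⌊ 2 ^ i ≤? w x y ⌋)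
             λ x y → cong (λ z → ⌊ 2 ^ i ≤? z ⌋) (w-sym x y)) ⟩
      2 ^ m′ * (2 ^ i) ^ m′ * (2 ^ m′ * (weightedHom es (level-set i) * n ^ (2 * m′)))
        ≡⟨ e₃ (2 ^ m′) (2 ^ m′) ((2 ^ i) ^ m′) (weightedHom es (level-set i)) (n ^ (2 * m′)) ⟩
      2 ^ m′ * 2 ^ m′ * ((2 ^ i) ^ m′ * weightedHom es (level-set i) * n ^ (2 * m′))
        ≤⟨ *-mono-≤ (≤-reflexive (sym (^-distribʳ-* 2 2 m′))) (*-monoˡ-≤ (n ^ (2 * m′)) scaled) ⟩
      4 ^ m′ * X ∎
      where
      e₄ : ∀ a b c d → a * (b * (c * d)) ≡ b * c * (a * d)
      e₄ = solve-∀
      scaled : (2 ^ i) ^ m′ * weightedHom es (level-set i) ≤ weightedHom es w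
      scaled = ≤-trans (≤-reflexive (sym (weightedHom-scale es (2 ^ i) (level-set i))))
        (weightedHom-mono es λ x y → 2^i*threshold≤y (w x y) i)

  -- `power-trick` applies with `y` and `x` the two sides of the goal, since totals, counts and
  -- orders of tensor powers are all exact `k`-th powers.
  sidorenko-weighted : (w : Fin n → Fin n → ℕ) → (∀ x y → w x y ≡ w y x) →
    ∀ l → (∀ x y → w x y ≤ 2 ^ l) →
    n ^ v′ * total w ^ m′ ≤ weightedHom es w * n ^ (2 * m′)
  sidorenko-weighted {n} w w-sym l w≤ = power-trick 4 l m′ _ _ λ k → begin
    (n ^ v′ * total w ^ m′) ^ k
      ≡⟨ trans (^-distribʳ-* (n ^ v′) _ k) (cong₂ _*_ (^-swap n v′ k)
           (trans (^-swap (total w) m′ k) (cong (_^ m′) (sym (total-tensorPower w k))))) ⟩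
    (n ^ k) ^ v′ * total (tensorPower w k) ^ m′
      ≤⟨ sidorenko-bounded (tensorPower w k) (tensorPower-sym w w-sym k) (k * l) (tensorPower-≤ w l w≤ k) ⟩
    (4 * suc (k * l)) ^ m′ * (weightedHom es (tensorPower w k) * (n ^ k) ^ (2 * m′))
      ≡⟨ cong ((4 * suc (k * l)) ^ m′ *_) (trans
           (cong₂ _*_ (weightedHom-tensorPower es w k) (^-swap n k (2 * m′)))
           (sym (^-distribʳ-* (weightedHom es w) (n ^ (2 * m′)) k))) ⟩
    (4 * suc (k * l)) ^ m′ * (weightedHom es w * n ^ (2 * m′)) ^ k ∎
    where
    open ≤-Reasoning
    ^-swap : ∀ x a b → (x ^ a) ^ b ≡ (x ^ b) ^ a
    ^-swap x a b = trans (^-*-assoc x a b) (trans (cong (x ^_) (*-comm a b)) (sym (^-*-assoc x b a)))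

-- From the codegree inequality to subdivisions

-- The subdivision has `2 * m′` edges, so the edge count enters as `(D * D) ^ m′`, with
-- `D * D ≤ N * s`. One `N ^ m′` from this bound and one from the middle vertices balance the
-- additional `N ^ (2 * m′)` on the right.
subdivision-sidorenko : (H : Graph) →
  ((G : Graph) → order G ^ order H * total (codegree G) ^ numEdges H
    ≤ weightedHom (edges H) (codegree G) * order G ^ (2 * numEdges H)) →
  Sidorenko (subdivision H)
subdivision-sidorenko H bound G = begin
  N ^ (v′ + m′) * D ^ numEdges (subdivision H)
    ≡⟨ cong₂ _*_ (^-distribˡ-+-* N v′ m′) D^ ⟩
  N ^ v′ * N ^ m′ * (D * D) ^ m′        ≤⟨ *-monoʳ-≤ (N ^ v′ * N ^ m′) (^-monoˡ-≤ m′ D*D≤N*s) ⟩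
  N ^ v′ * N ^ m′ * (N * s) ^ m′        ≡⟨ cong (N ^ v′ * N ^ m′ *_) (^-distribʳ-* N s m′) ⟩
  N ^ v′ * N ^ m′ * (N ^ m′ * s ^ m′)       ≡⟨ e₁ (N ^ v′) (N ^ m′) (s ^ m′) ⟩
  N ^ v′ * s ^ m′ * (N ^ m′ * N ^ m′)       ≤⟨ *-monoˡ-≤ (N ^ m′ * N ^ m′) (bound G) ⟩
  hom * N ^ (2 * m′) * (N ^ m′ * N ^ m′)    ≡⟨ *-assoc hom _ _ ⟩
  hom * (N ^ (2 * m′) * (N ^ m′ * N ^ m′)) ≡⟨ cong₂ _*_ (homCount-subdivision H G) N^ ⟨
  homCount (subdivision H) G * N ^ (2 * numEdges (subdivision H)) ∎
  where
  open ≤-Reasoning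
  N = order G
  v′ = order H
  m′ = numEdges H
  D = 2 * numEdges G
  s = total (codegree G)
  hom = weightedHom (edges H) (codegree G)
  V = allFin N
  e₁ : ∀ x y z → x * y * (y * z) ≡ x * z * (y * y)
  e₁ = solve-∀

  D^ : D ^ numEdges (subdivision H) ≡ (D * D) ^ m′
  D^ = trans (cong (D ^_) (numEdges-subdivision H)) (trans (^-2* D m′) (sym (^-distribʳ-* D D m′)))

  N^ : N ^ (2 * numEdges (subdivision H)) ≡ N ^ (2 * m′) * (N ^ m′ * N ^ m′)
  N^ = trans (cong (λ k → N ^ (2 * k)) (numEdges-subdivision H))
    (trans (^-2* N (2 * m′)) (cong (N ^ (2 * m′) *_) (^-2* N m′)))

  -- The factor 1 matches `gram-bilinear`, which makes `s` the sum of squared degrees.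
  degree : Fin N → ℕ
  degree z = ∑ V λ x → 1 * adjacency G x z

  D≡ : D ≡ ∑ V λ z → 1 * degree z
  D≡ = trans (2*numEdges G) (trans (Sum.fold-swap V V _) (Sum.fold-cong V λ z →
    trans (Sum.fold-cong V λ x → sym (*-identityˡ (adjacency G x z))) (sym (*-identityˡ (degree z)))))

  s≡ : s ≡ ∑ V λ z → degree z * degree z
  s≡ = trans (Sum.fold-cong V λ x → Sum.fold-cong V λ y → sym (*-identityʳ (codegree G x y)))
    (gram-bilinear (adjacency G) (λ _ → 1) (λ _ → 1))

  D*D≤N*s : D * D ≤ N * s
  D*D≤N*s = subst₂ _≤_ (cong (λ d → d * d) (sym D≡))
    (cong₂ _*_ (trans (∑-allFin-const N 1) (*-identityʳ N)) (sym s≡))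
    (unweighted-cauchy-schwarz V (λ _ → 1) degree)

theorem1p3 : ((k : ℕ) → 1 ≤ k → Sidorenko (subdivision (complete k)))
    × ((H : Graph) → Sidorenko H → Sidorenko (subdivision H))
theorem1p3 = cliques , λ H sidorenko → subdivision-sidorenko H λ G →
  sidorenko-weighted H sidorenko (codegree G) (codegree-sym G) (order G) (codegree-≤ G)
  where
  cliques : (k : ℕ) → 1 ≤ k → Sidorenko (subdivision (complete k))
  cliques (suc k) _ = subdivision-sidorenko (complete (suc k)) λ G → Clique.clique-bound (adjacency G) k

  codegree-sym : (G : Graph) → ∀ x y → codegree G x y ≡ codegree G y x
  codegree-sym G x y = Sum.fold-cong (allFin (order G)) λ z → *-comm (adjacency G x z) (adjacency G y z)

  -- A crude bound suffices: any power of two above the entries serves in `sidorenko-weighted`.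
  codegree-≤ : (G : Graph) → ∀ x y → codegree G x y ≤ 2 ^ order G
  codegree-≤ G x y = begin
    codegree G x y
      ≤⟨ ∑-mono (allFin N) (λ z → *-mono-≤ (bit≤1 (adj G x z)) (bit≤1 (adj G y z))) ⟩
    (∑ (allFin N) λ _ → 1) ≡⟨ trans (∑-allFin-const N 1) (*-identityʳ N) ⟩
    N                      ≤⟨ <⇒≤ (n<2^n N) ⟩
    2 ^ N ∎
    where
    open ≤-Reasoning
    N = order G
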